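{- Let $m\ge 2$ be an even integer and $n\ge 1$ an integer. A cyclic and $\phi_n$-symmetric hamiltonian cycle system of $K_{m\times n}$ exists if and only if $n$ is even and, whenever $n\equiv 2\pmod 4$, also $m\equiv 2\pmod 4$.
   Context: $K_{m\times n}$ is the complete multipartite graph with $m$ parts of size $n$. Identify its vertex set with $\mathbb{Z}_{mn}$, the parts being the cosets of the subgroup $m\mathbb{Z}_{mn}$ (of order $n$); two vertices $x,y$ are adjacent iff $x-y\notin m\mathbb{Z}_{mn}$. A hamiltonian cycle system (HCS) of a graph is a set of cycles through all vertices whose edge sets partition the edge set of the graph. An HCS of $K_{m\times n}$ is cyclic if whenever $(c_0,\dots,c_{\ell-1})$ is a cycle of the system, so is $(c_0+1,\dots,c_{\ell-1}+1)$. Let $\phi_n$ be the permutation $x\mapsto x+m$ of $\mathbb{Z}_{mn}$ (a fixed-point-free automorphism of $K_{m\times n}$ of order $n$). An HCS is $\phi_n$-symmetric if every cycle of the system is mapped to itself by $\phi_n$. -}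

module Defs where

open import Data.Nat using (ℕ; zero; suc; _+_; _*_; _∸_; _<_; _≤_; _%_)
open import Data.Fin using (Fin)
open import Data.Product using (Σ; _×_; ∃)
open import Data.Sum using (_⊎_)
open import Relation.Binary.PropositionalEquality using (_≡_)
open import Relation.Nullary using (¬_)
open import Function.Bundles using (_⇔_)

-- x mod N (genuine remainder for N ≥ 1; unused junk value for N = 0)
modN : ℕ → ℕ → ℕ
modN zero    x = x
modN (suc N) x = x % suc N

-- Vertices of K_{m×n} are the naturals x < m*n (i.e. Z_{mn}).
-- x,y adjacent iff x - y ∉ mZ_{mn}, i.e. x ≢ y (mod m)  (as m ∣ mn).
Adj : ℕ → ℕ → ℕ → Set
Adj m x y = ¬ (modN m x ≡ modN m y)

UEdge : ℕ → ℕ → ℕ → ℕ → Set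
UEdge a b x y = (a ≡ x × b ≡ y) ⊎ (a ≡ y × b ≡ x)

-- A closed walk of length N is given by c 0, …, c (N-1) (values of c at
-- indices ≥ N are irrelevant).  {x,y} is an edge of the cycle
-- (c 0, …, c (N-1)) iff it is {c i, c (i+1)} for some i+1 < N,
-- or it is the closing edge {c (N-1), c 0}.
InCycle : ℕ → (ℕ → ℕ) → ℕ → ℕ → Set
InCycle N c x y =
  (Σ ℕ λ i → suc i < N × UEdge (c i) (c (suc i)) x y) ⊎ UEdge (c (N ∸ 1)) (c 0) x y

record HamCycle (m n : ℕ) (c : ℕ → ℕ) : Set where
  field
    length≥3  : 3 ≤ m * n
    inRange   : ∀ i → i < m * n → c i < m * n
    injective : ∀ i j → i < m * n → j < m * n → c i ≡ c j → i ≡ j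
    adjacent  : ∀ i → suc i < m * n → Adj m (c i) (c (suc i))
    closing   : Adj m (c (m * n ∸ 1)) (c 0)

SameCycle : ℕ → (ℕ → ℕ) → (ℕ → ℕ) → Set
SameCycle N c d = ∀ x y → InCycle N c x y ⇔ InCycle N d x y

shift : ℕ → ℕ → (ℕ → ℕ) → (ℕ → ℕ)
shift N k c i = modN N (c i + k)

-- A hamiltonian cycle system of K_{m×n}: finitely many hamiltonian cycles
-- C 0, …, C (k-1) such that every edge of K_{m×n} lies in exactly one of them
-- (edges of cycles are edges of the graph by HamCycle).
record HCS (m n : ℕ) (k : ℕ) (C : Fin k → ℕ → ℕ) : Set where
  field
    hamiltonian : ∀ j → HamCycle m n (C j)
    partition   : ∀ x y → x < m * n → y < m * n → Adj m x y →
                  Σ (Fin k) λ j → InCycle (m * n) (C j) x y ×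
                    (∀ j' → InCycle (m * n) (C j') x y → j' ≡ j)

Cyclic : (m n k : ℕ) → (Fin k → ℕ → ℕ) → Set
Cyclic m n k C = ∀ j → Σ (Fin k) λ j' → SameCycle (m * n) (C j') (shift (m * n) 1 (C j))

PhiSymmetric : (m n k : ℕ) → (Fin k → ℕ → ℕ) → Set
PhiSymmetric m n k C = ∀ j → SameCycle (m * n) (shift (m * n) m (C j)) (C j)

CyclicSymHCSExists : ℕ → ℕ → Set
CyclicSymHCSExists m n =
  Σ ℕ λ k → Σ (Fin k → ℕ → ℕ) λ C → HCS m n k C × Cyclic m n k C × PhiSymmetric m n k C

{-# OPTIONS --safe #-}
module Submission where

-- Call ±d the class of an edge {x, x + d}.
--
-- Necessity. Counting the edges at a vertex gives 2k = n(m − 1), so n is even. Put H = N/2 with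
-- N = mn. Translation by H is a multiple of φₙ, hence stabilises every cycle; it acts on it as a
-- rotation, since a reflection would fix an edge {x, x + H}, and H ∈ mℤ. So if r is the least
-- period of the sequence of classes along a cycle c, and c(i + r) = c(i) + t, then t ≡ r (mod 2),
-- and an even number of the r classes of c are even. Hence the number n(m − 2)/4 of even classes
-- is even, which fails for n ≡ 2, m ≡ 0 (mod 4).
--
-- Sufficiency. A walk w : ℕ → ℤ with w(i + r) = w(i) + r, r ∣ m, and w(0), …, w(r − 1) distinct
-- modulo r gives r hamiltonian cycles w + s (s < r), stabilised by φₙ. They form a system as soon as
-- the steps w(i + 1) − w(i), i < r, of all the walks hit every class exactly once. The even classes
-- qm + 2, qm + 4, …, qm + m − 2 of a "row" q < n/2 are the steps of a zigzag through the
-- even residues. Two zigzags, on the even and on the odd residues, make a walk of period m with two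
-- odd steps; for m/2 odd, one zigzag closed by the step 1 makes a walk of period m/2. The remaining
-- odd classes are paired as {g − 2, g}, the steps of the walk 0, g, 2 of period 2. The number of steps
-- equals the number of classes, so it is enough that every class is hit.

open import Defs
open import Algebra.Bundles using (CommutativeRing)
open import Data.Bool using (Bool; true; false; not; if_then_else_; _∧_; _xor_)
open import Data.Bool.Properties using (not-involutive; ∧-zeroʳ; ∧-identityʳ; xor-identityʳ; xor-∧-commutativeRing)
open import Algebra.Properties.CommutativeMonoid.Sum (CommutativeRing.+-commutativeMonoid xor-∧-commutativeRing) using (sum; sum-cong-≗; sum-replicate-zero; ∑-comm)
open import Data.Empty using (⊥; ⊥-elim)
open import Data.Fin as Fin using (Fin; toℕ; fromℕ<; splitAt; remQuot; combine; opposite)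
import Data.Fin.Properties as Finₚ
open import Data.Integer as ℤ using (ℤ; +_; -[1+_]; _+_; _-_; _*_; -_; _%ℕ_; _/ℕ_)
import Data.Integer.Properties as ℤₚ
open import Data.Integer.DivMod using (n%ℕd<d; a≡a%ℕn+[a/ℕn]*n)
open import Data.Integer.Tactic.RingSolver using (solve-∀)
open import Data.Nat as ℕ using (ℕ; zero; suc; _≤_; _<_; z≤n; s≤s; _%_; _/_; NonZero)
import Data.Nat.Properties as ℕₚ
import Data.Nat.DivMod as ℕᵈ
import Data.Nat.Tactic.RingSolver as ℕS
open import Data.Nat.Divisibility using (_∣_; divides; ∣-trans; ∣⇒≤; ∣m+n∣m⇒∣n; ∣m⇒∣m*n)
open import Data.Product using (Σ; ∃; _×_; _,_; proj₁; proj₂)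
open import Data.Sum as Sum using (_⊎_; inj₁; inj₂; [_,_]′; swap)
open import Data.Sum.Function.Propositional using (_⊎-↔_)
open import Function using (_∘_; case_of_)
open import Function.Bundles using (_⇔_; mk⇔; Equivalence; _↔_; mk↔ₛ′; Inverse)
open import Function.Construct.Composition using (_↔-∘_)
open import Relation.Binary.Definitions using (tri<; tri≈; tri>)
open import Relation.Binary.PropositionalEquality
open import Relation.Nullary using (¬_; Dec; yes; no; does)
open import Relation.Nullary.Decidable using (dec-true; dec-false; _⊎-dec_; map′)

-- Congruence of integers

-- The count of even classes needs every class to be charged to one cycle. Edges of the same class
-- are translates of each other, so cycles with a common class are translates of each other and have
-- all their classes in common. Within one least period no class repeats, since a repetition would
-- be a translation symmetry of the cycle, hence a rotation by less than `r`. The constructions are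
-- shaped by the point where a zigzag ends. With h = m/2 vertices it ends, for h odd, at h - 1
-- whatever its row is; the two odd steps of a long walk are then of the form G and 2 - G, exactly
-- like those of a walk of period 2. For h even it ends at -(qm + h), so the rows enter the odd
-- steps of a long walk. Joining row l to row n/2 - 1 - l, with the second zigzag reversed in sign,
-- makes the sum of these steps a multiple of 2m that varies with l; that is why the long walks then
-- take odd classes next to multiples of m.

infix 4 _≅_[_]
record _≅_[_] (x y : ℤ) (N : ℕ) : Set where
  constructor by
  field
    quot : ℤ
    eq   : x ≡ y + quot * + N

module _ {N : ℕ} where

  ≅-by : ∀ {x y} k → x - y ≡ k * + N → x ≅ y [ N ]
  ≅-by {x} {y} k e = by k (trans (lem x y) (cong (λ z → y + z) e))
    where
    lem : ∀ x y → x ≡ y + (x - y)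
    lem = solve-∀

  quotient-eq : ∀ {x y} (p : x ≅ y [ N ]) → x - y ≡ _≅_[_].quot p * + N
  quotient-eq {y = y} (by k refl) = lem y (k * + N)
    where
    lem : ∀ y z → (y + z) - y ≡ z
    lem = solve-∀

  -- Reduces a congruence to a linear identity over the integers, which the ring solver proves;
  -- `≅-via⁻` does the same when the known difference has the opposite sign.
  ≅-via : ∀ {x y u v} → u ≅ v [ N ] → x - y ≡ u - v → x ≅ y [ N ]
  ≅-via p e = ≅-by (_≅_[_].quot p) (trans e (quotient-eq p))

  ≅-via⁻ : ∀ {x y u v} → u ≅ v [ N ] → x - y ≡ v - u → x ≅ y [ N ]
  ≅-via⁻ {u = u} {v} p e = ≅-by (- k) (trans e (trans (lem u v)
      (trans (cong -_ (quotient-eq p)) (ℤₚ.neg-distribˡ-* k (+ N)))))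
    where
    k = _≅_[_].quot p
    lem : ∀ u v → v - u ≡ - (u - v)
    lem = solve-∀

  ≅-reflexive : ∀ {x y} → x ≡ y → x ≅ y [ N ]
  ≅-reflexive {x} refl = by (+ 0) (lem x (+ N))
    where
    lem : ∀ x n → x ≡ x + + 0 * n
    lem = solve-∀

  ≅-refl : ∀ {x} → x ≅ x [ N ]
  ≅-refl = ≅-reflexive refl

  ≅-sym : ∀ {x y} → x ≅ y [ N ] → y ≅ x [ N ]
  ≅-sym p = ≅-via⁻ p refl

  ≅-trans : ∀ {x y z} → x ≅ y [ N ] → y ≅ z [ N ] → x ≅ z [ N ]
  ≅-trans {z = z} (by k refl) (by l refl) = by (l + k) (lem z k l (+ N))
    where
    lem : ∀ z k l n → z + l * n + k * n ≡ z + (l + k) * n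
    lem = solve-∀

  +-≅ : ∀ {x y u v} → x ≅ y [ N ] → u ≅ v [ N ] → x + u ≅ y + v [ N ]
  +-≅ {y = y} {v = v} (by k refl) (by l refl) = by (k + l) (lem y v k l (+ N))
    where
    lem : ∀ y v k l n → (y + k * n) + (v + l * n) ≡ y + v + (k + l) * n
    lem = solve-∀

  neg-≅ : ∀ {x y} → x ≅ y [ N ] → - x ≅ - y [ N ]
  neg-≅ {x} {y} p = ≅-via⁻ p (lem x y)
    where
    lem : ∀ x y → - x - - y ≡ y - x
    lem = solve-∀

  minus-≅ : ∀ {x y u v} → x ≅ y [ N ] → u ≅ v [ N ] → x - u ≅ y - v [ N ]
  minus-≅ p q = +-≅ p (neg-≅ q)

  *-≅ : ∀ {x y} z → x ≅ y [ N ] → z * x ≅ z * y [ N ]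
  *-≅ {y = y} z (by k refl) = by (z * k) (lem z y k (+ N))
    where
    lem : ∀ z y k n → z * (y + k * n) ≡ z * y + z * k * n
    lem = solve-∀

  +-cancelʳ-≅ : ∀ {x y} z → x + z ≅ y + z [ N ] → x ≅ y [ N ]
  +-cancelʳ-≅ {x} {y} z p = ≅-via p (lem x y z)
    where
    lem : ∀ x y z → x - y ≡ (x + z) - (y + z)
    lem = solve-∀

  +-cancelˡ-≅ : ∀ {x y} z → z + x ≅ z + y [ N ] → x ≅ y [ N ]
  +-cancelˡ-≅ {x} {y} z p = ≅-via p (lem x y z)
    where
    lem : ∀ x y z → x - y ≡ (z + x) - (z + y)
    lem = solve-∀

  multiple≅0 : ∀ k → k * + N ≅ + 0 [ N ]
  multiple≅0 k = by k (sym (ℤₚ.+-identityˡ _))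

  +multiple-≅ : ∀ x k → x + k * + N ≅ x [ N ]
  +multiple-≅ x k = by k refl

≅-weaken : ∀ {M N x y} → M ∣ N → x ≅ y [ N ] → x ≅ y [ M ]
≅-weaken {M} {y = y} (divides q refl) (by k refl) =
  by (k * + q) (cong (λ z → y + z) (trans (cong (k *_) (ℤₚ.pos-* q M)) (sym (ℤₚ.*-assoc k (+ q) (+ M)))))

private
  no-multiple : ∀ {N x y} k → x < N → ¬ (+ x ≡ + y + + suc k * + N)
  no-multiple {N} {x} {y} k x<N e = ℕₚ.<⇒≱ x<N
    (ℕₚ.≤-trans (ℕₚ.m≤m+n N (k ℕ.* N)) (ℕₚ.≤-trans (ℕₚ.m≤n+m (suc k ℕ.* N) y)
      (ℕₚ.≤-reflexive (sym (ℤₚ.+-injective (trans e (cong (λ z → + y + z) (sym (ℤₚ.pos-* (suc k) N)))))))))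

≅⇒≡ : ∀ {N x y} → x < N → y < N → + x ≅ + y [ N ] → x ≡ y
≅⇒≡ {N} {x} {y} x<N y<N (by (+ zero) e) = ℤₚ.+-injective (trans e (ℤₚ.+-identityʳ (+ y)))
≅⇒≡ x<N y<N (by (+ suc k) e) = ⊥-elim (no-multiple k x<N e)
≅⇒≡ x<N y<N p@(by -[1+ k ] _) = ⊥-elim (no-multiple k y<N (_≅_[_].eq (≅-sym p)))

module _ {N : ℕ} .{{_ : NonZero N}} where

  %ℕ-≅ : ∀ z → + (z %ℕ N) ≅ z [ N ]
  %ℕ-≅ z = ≅-sym (by (z /ℕ N) (a≡a%ℕn+[a/ℕn]*n z N))

  %-≅ : ∀ x → + (x % N) ≅ + x [ N ]
  %-≅ x = %ℕ-≅ (+ x)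

  %≡⇒≅ : ∀ x y → x % N ≡ y % N → + x ≅ + y [ N ]
  %≡⇒≅ x y e = ≅-trans (≅-sym (%-≅ x)) (≅-trans (≅-reflexive (cong +_ e)) (%-≅ y))

  ≅⇒%≡ : ∀ {x y} → + x ≅ + y [ N ] → x % N ≡ y % N
  ≅⇒%≡ {x} {y} p = ≅⇒≡ (ℕᵈ.m%n<n x N) (ℕᵈ.m%n<n y N) (≅-trans (%-≅ x) (≅-trans p (≅-sym (%-≅ y))))

modN≡% : ∀ N .{{_ : NonZero N}} x → modN N x ≡ x % N
modN≡% (suc N) x = refl

Adj⇒≇ : ∀ m .{{_ : NonZero m}} {x y} → Adj m x y → ¬ (+ x ≅ + y [ m ])
Adj⇒≇ m {x} {y} adj p = adj (trans (modN≡% m x) (trans (≅⇒%≡ p) (sym (modN≡% m y))))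

≇⇒Adj : ∀ m .{{_ : NonZero m}} {x y} → ¬ (+ x ≅ + y [ m ]) → Adj m x y
≇⇒Adj m {x} {y} ¬p e = ¬p (%≡⇒≅ x y (trans (sym (modN≡% m x)) (trans e (modN≡% m y))))

-- Cycles as closed walks on the integers modulo N

-- The index is any natural number, not one below `N`: for a walk that is periodic modulo `N` the
-- closing edge is then a step like all others.
record Step (N : ℕ) (w : ℕ → ℤ) (x y : ℤ) : Set where
  constructor step
  field
    index  : ℕ
    source : w index ≅ x [ N ]
    target : w (suc index) ≅ y [ N ]

Link : ℕ → (ℕ → ℤ) → ℤ → ℤ → Set
Link N w x y = Step N w x y ⊎ Step N w y x

-- The integer walk `w` reads the cycle `c` round and round modulo `N`. Translations and symmetries
-- are studied on `w`, and `InCycle` is reached only through this record.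
record Lift (N : ℕ) .{{_ : NonZero N}} (c : ℕ → ℕ) (w : ℕ → ℤ) : Set where
  field
    range : ∀ i → i < N → c i < N
    lift  : ∀ i → w i ≅ + c (i % N) [ N ]

  range% : ∀ i → c (i % N) < N
  range% i = range (i % N) (ℕᵈ.m%n<n i N)

  InCycle⇒Link : ∀ {x y} → InCycle N c x y → Link N w (+ x) (+ y)
  InCycle⇒Link {x} {y} = [ inner , outer ]′
    where
    at : ∀ i j → j < N → i % N ≡ j → w i ≅ + c j [ N ]
    at i j j<N e = subst (λ k → w i ≅ + c k [ N ]) e (lift i)
    at< : ∀ i → i < N → w i ≅ + c i [ N ]
    at< i i<N = at i i i<N (ℕᵈ.m<n⇒m%n≡m i<N)
    edge : ∀ i j → w i ≅ + c (i % N) [ N ] → UEdge (c (i % N)) (c j) x y → w (suc i) ≅ + c j [ N ] → Link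
        N w (+ x) (+ y)
    edge i j p (inj₁ (refl , refl)) q = inj₁ (step i p q)
    edge i j p (inj₂ (refl , refl)) q = inj₂ (step i p q)
    inner : Σ ℕ (λ i → suc i < N × UEdge (c i) (c (suc i)) x y) → Link N w (+ x) (+ y)
    inner (i , si<N , e) = edge i (suc i) (lift i)
      (subst (λ k → UEdge (c k) (c (suc i)) x y) (sym (ℕᵈ.m<n⇒m%n≡m (ℕₚ.<-trans (ℕₚ.n<1+n i) si<N))) e)
          (at< (suc i) si<N)
    N>0 : 0 < N
    N>0 = ℕₚ.n≢0⇒n>0 (ℕ.≢-nonZero⁻¹ N)
    pred<N : N ℕ.∸ 1 < N
    pred<N = ℕₚ.∸-monoʳ-< {N} (s≤s z≤n) N>0
    outer : UEdge (c (N ℕ.∸ 1)) (c 0) x y → Link N w (+ x) (+ y)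
    outer e = edge (N ℕ.∸ 1) 0 (lift _) (subst (λ k → UEdge (c k) (c 0) x y) (sym (ℕᵈ.m<n⇒m%n≡m pred<N)) e)
      (at _ 0 N>0 (trans (cong (_% N) (ℕₚ.suc-pred N)) (ℕᵈ.n%n≡0 N)))

  Link⇒InCycle : ∀ {x y} → x < N → y < N → Link N w (+ x) (+ y) → InCycle N c x y
  Link⇒InCycle {x} {y} x<N y<N = [ to x<N y<N inj₁ , to y<N x<N inj₂ ]′
    where
    to : ∀ {x′ y′} → x′ < N → y′ < N → (∀ {a b} → a ≡ x′ × b ≡ y′ → UEdge a b x y) → Step N w (+ x′)
        (+ y′) → InCycle N c x y
    to {x′} {y′} x<N y<N u (step i p q) with suc (i % N) ℕ.<? N
    ... | yes si<N = inj₁ (i % N , si<N , u (val i x<N p , trans (cong c (sym si%)) (val (suc i) y<N q)))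
      where
      val : ∀ i {x} → x < N → w i ≅ + x [ N ] → c (i % N) ≡ x
      val i x<N p = ≅⇒≡ (range% i) x<N (≅-trans (≅-sym (lift i)) p)
      si% : suc i % N ≡ suc (i % N)
      si% = trans (≅⇒%≡ (+-≅ (≅-refl {x = + 1}) (≅-sym (%-≅ i)))) (ℕᵈ.m<n⇒m%n≡m si<N)
    ... | no si≮N = inj₂ (u (trans (cong c (sym i%)) (val i x<N p) , trans (cong c (sym si%))
        (val (suc i) y<N q)))
      where
      val : ∀ i {x} → x < N → w i ≅ + x [ N ] → c (i % N) ≡ x
      val i x<N p = ≅⇒≡ (range% i) x<N (≅-trans (≅-sym (lift i)) p)
      e : suc (i % N) ≡ N
      e = ℕₚ.≤-antisym (ℕᵈ.m%n<n i N) (ℕₚ.≮⇒≥ si≮N)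
      i% : i % N ≡ N ℕ.∸ 1
      i% = cong (ℕ._∸ 1) e
      si% : suc i % N ≡ 0
      si% = trans (≅⇒%≡ (+-≅ (≅-refl {x = + 1}) (≅-sym (%-≅ i)))) (trans (cong (_% N) e) (ℕᵈ.n%n≡0 N))

  InCycle⇒< : ∀ {x y} → InCycle N c x y → x < N × y < N
  InCycle⇒< = bounds
    where
    pred<N : N ℕ.∸ 1 < N
    pred<N = ℕₚ.∸-monoʳ-< {N} (s≤s z≤n) (ℕₚ.n≢0⇒n>0 (ℕ.≢-nonZero⁻¹ N))
    edge : ∀ {i j x y} → i < N → j < N → UEdge (c i) (c j) x y → x < N × y < N
    edge i<N j<N (inj₁ (refl , refl)) = range _ i<N , range _ j<N
    edge i<N j<N (inj₂ (refl , refl)) = range _ j<N , range _ i<N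
    bounds : ∀ {x y} → InCycle N c x y → x < N × y < N
    bounds (inj₁ (i , si<N , e)) = edge (ℕₚ.<-trans (ℕₚ.n<1+n i) si<N) si<N e
    bounds (inj₂ e) = edge pred<N (ℕₚ.n≢0⇒n>0 (ℕ.≢-nonZero⁻¹ N)) e


open Lift

Link-map : ∀ {N w w′} (f : ℕ → ℕ) → (∀ i → w′ (f i) ≅ w i [ N ] × w′ (suc (f i)) ≅ w (suc i) [ N ]) →
    ∀ {x y} → Link N w x y → Link N w′ x y
Link-map {N} {w} {w′} f h = Sum.map go go
  where
  go : ∀ {x y} → Step N w x y → Step N w′ x y
  go (step i p q) = step (f i) (≅-trans (proj₁ (h i)) p) (≅-trans (proj₂ (h i)) q)

SameCycle-from-Links : ∀ {N} .{{_ : NonZero N}} {c c′ w w′} → Lift N c w → Lift N c′ w′ →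
  (∀ x y → Link N w x y → Link N w′ x y) → (∀ x y → Link N w′ x y → Link N w x y) → SameCycle N c c′
SameCycle-from-Links L L′ f g x y = mk⇔ (conv L L′ f) (conv L′ L g)
  where
  conv : ∀ {c c′ w w′} (L : Lift _ c w) (L′ : Lift _ c′ w′) → (∀ x y → Link _ w x y → Link _ w′ x y) →
      InCycle _ c x y → InCycle _ c′ x y
  conv L L′ f p = let x< , y< = InCycle⇒< L p in Link⇒InCycle L′ x< y< (f _ _ (InCycle⇒Link L p))

shift-Lift : ∀ {N} .{{_ : NonZero N}} {c w} k → Lift N c w → Lift N (shift N k c) (λ i → w i + + k)
range (shift-Lift {N} {c} k L) i i<N = subst (_< N) (sym (modN≡% N _)) (ℕᵈ.m%n<n (c i ℕ.+ k) N)
lift (shift-Lift {N} {c} k L) i = ≅-trans (+-≅ (lift L i) ≅-refl)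
  (≅-trans (≅-sym (%-≅ (c (i % N) ℕ.+ k))) (≅-reflexive (cong +_ (sym (modN≡% N _)))))

-- Differences up to sign

infix 4 _≅±_[_]
_≅±_[_] : ℤ → ℤ → ℕ → Set
x ≅± y [ N ] = x ≅ y [ N ] ⊎ x ≅ - y [ N ]

module _ {N : ℕ} where

  ±-sym : ∀ {x y} → x ≅± y [ N ] → y ≅± x [ N ]
  ±-sym (inj₁ p) = inj₁ (≅-sym p)
  ±-sym {x} {y} (inj₂ p) = inj₂ (≅-via p (lem x y))
    where
    lem : ∀ x y → y - - x ≡ x - - y
    lem = solve-∀

  ±-trans : ∀ {x y z} → x ≅± y [ N ] → y ≅± z [ N ] → x ≅± z [ N ]
  ±-trans (inj₁ p) (inj₁ q) = inj₁ (≅-trans p q)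
  ±-trans (inj₁ p) (inj₂ q) = inj₂ (≅-trans p q)
  ±-trans (inj₂ p) (inj₁ q) = inj₂ (≅-trans p (neg-≅ q))
  ±-trans {z = z} (inj₂ p) (inj₂ q) =
    inj₁ (≅-trans p (≅-trans (neg-≅ q) (≅-reflexive (ℤₚ.neg-involutive z))))

-- Representatives of the classes ±d

module Classes (m′ b : ℕ) (N : ℕ) (N≡ : N ≡ b ℕ.* suc m′ ℕ.+ b ℕ.* suc m′) where

  private
    m H : ℕ
    m = suc m′
    H = b ℕ.* suc m′

  repℕ : Fin b → Fin m′ → ℕ
  repℕ q ρ = toℕ (combine q (Fin.suc ρ))

  rep : Fin b → Fin m′ → ℤ
  rep q ρ = + repℕ q ρ

  repℕ≡ : ∀ q ρ → repℕ q ρ ≡ m ℕ.* toℕ q ℕ.+ suc (toℕ ρ)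
  repℕ≡ q ρ = Finₚ.toℕ-combine q (Fin.suc ρ)

  repℕ<H : ∀ q ρ → repℕ q ρ < H
  repℕ<H q ρ = Finₚ.toℕ<n (combine q (Fin.suc ρ))

  H≤N : H ≤ N
  H≤N = ℕₚ.≤-trans (ℕₚ.m≤m+n H H) (ℕₚ.≤-reflexive (sym N≡))

  m∣N : m ∣ N
  m∣N = divides (b ℕ.+ b) (trans N≡ (sym (ℕₚ.*-distribʳ-+ m b b)))

  -- All representatives lie strictly between 0 and N/2, so a sum of two of them lies strictly
  -- between 0 and N. In particular none is congruent to its own negative.
  rep≇-rep : ∀ q ρ q′ ρ′ → ¬ (rep q ρ ≅ - rep q′ ρ′ [ N ])
  rep≇-rep q ρ q′ ρ′ p = nonzero (≅⇒≡ sum<N N>0 sum≅0)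
    where
    x = repℕ q ρ
    y = repℕ q′ ρ′
    sum<N : x ℕ.+ y < N
    sum<N = ℕₚ.<-≤-trans (ℕₚ.+-mono-< (repℕ<H q ρ) (repℕ<H q′ ρ′)) (ℕₚ.≤-reflexive (sym N≡))
    N>0 : 0 < N
    N>0 = ℕₚ.≤-<-trans z≤n sum<N
    lem : ∀ u v → (u + v) - + 0 ≡ u - - v
    lem = solve-∀
    sum≅0 : + (x ℕ.+ y) ≅ + 0 [ N ]
    sum≅0 = ≅-via p (lem (+ x) (+ y))
    nonzero : x ℕ.+ y ≢ 0
    nonzero e = case trans (sym (repℕ≡ q ρ)) (ℕₚ.m+n≡0⇒m≡0 x e) of λ e′ →
      case ℕₚ.m+n≡0⇒n≡0 (m ℕ.* toℕ q) e′ of λ ()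

  rep-injective : ∀ {q q′ ρ ρ′} → rep q ρ ≅± rep q′ ρ′ [ N ] → (q , ρ) ≡ (q′ , ρ′)
  rep-injective {q} {q′} {ρ} {ρ′} (inj₁ p)
    with Finₚ.combine-injective q (Fin.suc ρ) q′ (Fin.suc ρ′)
           (Finₚ.toℕ-injective (≅⇒≡ (ℕₚ.<-≤-trans (repℕ<H q ρ) H≤N) (ℕₚ.<-≤-trans (repℕ<H q′ ρ′) H≤N) p))
  ... | refl , refl = refl
  rep-injective {q} {q′} {ρ} {ρ′} (inj₂ p) = ⊥-elim (rep≇-rep q ρ q′ ρ′ p)

  rep≇0 : ∀ q ρ → ¬ (rep q ρ ≅ + 0 [ m ])
  rep≇0 q ρ p = case ≅⇒≡ (s≤s (Finₚ.toℕ<n ρ)) (s≤s z≤n) (≅-trans (≅-sym q≅) p) of λ ()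
    where
    lem : ∀ a b c d → a ≡ b * c + d → a ≡ d + c * b
    lem a b c d refl = lem′ b c d
      where
      lem′ : ∀ b c d → b * c + d ≡ d + c * b
      lem′ = solve-∀
    q≅ : rep q ρ ≅ + suc (toℕ ρ) [ m ]
    q≅ = by (+ toℕ q) (lem _ (+ m) (+ toℕ q) _
      (trans (cong +_ (repℕ≡ q ρ)) (cong (λ z → z + + suc (toℕ ρ)) (ℤₚ.pos-* m (toℕ q)))))

  repℕ-surjective : ∀ x → x < H → ¬ (+ x ≅ + 0 [ m ]) → ∃ λ q → ∃ λ ρ → repℕ q ρ ≡ x
  repℕ-surjective x x<H x≇0 with remQuot {b} m (fromℕ< x<H) in e
  ... | q , Fin.zero = ⊥-elim (x≇0 (by (+ toℕ q) x≡))
    where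
    x≡ : + x ≡ + 0 + + toℕ q * + m
    x≡ = trans (cong +_ (trans (sym (Finₚ.toℕ-fromℕ< x<H))
        (trans (cong toℕ (sym (Finₚ.combine-remQuot {b} m (fromℕ< x<H))))
           (trans (cong (λ p → toℕ (combine (proj₁ p) (proj₂ p))) e) (trans (Finₚ.toℕ-combine q Fin.zero)
             (trans (ℕₚ.+-identityʳ _) (ℕₚ.*-comm m (toℕ q))))))))
           (trans (ℤₚ.pos-* (toℕ q) m) (sym (ℤₚ.+-identityˡ _)))
  ... | q , Fin.suc ρ = q , ρ , trans (cong (λ p → toℕ (combine (proj₁ p) (proj₂ p))) (sym e))
          (trans (cong toℕ (Finₚ.combine-remQuot {b} m (fromℕ< x<H))) (Finₚ.toℕ-fromℕ< x<H))

  -- One of d and -d has a residue of at most N/2, and N/2 itself is excluded because it is a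
  -- multiple of `m`.
  rep-surjective : .{{_ : NonZero N}} → ∀ d → ¬ (d ≅ + 0 [ m ]) → ∃ λ q → ∃ λ ρ → d ≅± rep q ρ [ N ]
  rep-surjective d d≇0 with d %ℕ N ℕ.<? H
  ... | yes x<H = let q , ρ , e = repℕ-surjective (d %ℕ N) x<H λ p → d≇0 (≅-trans (≅-weaken m∣N (≅-sym (%ℕ-≅ d))) p) in
                  q , ρ , inj₁ (≅-trans (≅-sym (%ℕ-≅ d)) (≅-reflexive (cong +_ (sym e))))
  ... | no x≮H = let q , ρ , e = repℕ-surjective y y<H y≇0 in q , ρ , inj₂ (≅-trans (≅-sym y≅) (≅-reflexive (cong (λ z → - + z) (sym e))))
    where
    x = d %ℕ N
    y = N ℕ.∸ x
    x<N : x < N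
    x<N = n%ℕd<d d N
    lem : ∀ s t → - s - t ≡ + 0 - (s + t)
    lem = solve-∀
    xy : + y + + x ≡ + N
    xy = cong +_ (ℕₚ.m∸n+n≡m (ℕₚ.<⇒≤ x<N))
    y≅ : - + y ≅ d [ N ]
    y≅ = ≅-trans (≅-via⁻ {u = + N} (≅-trans (≅-reflexive (sym (ℤₚ.*-identityˡ (+ N)))) (multiple≅0 (+ 1)))
        (trans (lem (+ y) (+ x)) (cong (λ z → + 0 - z) xy))) (%ℕ-≅ d)
    y≇0 : ¬ (+ y ≅ + 0 [ m ])
    y≇0 p = d≇0 (≅-trans (≅-weaken m∣N (≅-sym y≅)) (neg-≅ p))
    y≤H : y ≤ H
    y≤H = ℕₚ.≤-trans (ℕₚ.∸-monoʳ-≤ N (ℕₚ.≮⇒≥ x≮H))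
        (ℕₚ.≤-reflexive (trans (cong (ℕ._∸ H) N≡) (ℕₚ.m+n∸n≡m H H)))
    y<H : y < H
    y<H = ℕₚ.≤∧≢⇒< y≤H λ e → y≇0 (≅-trans (≅-reflexive (trans (cong +_ e) (ℤₚ.pos-* b m)))
        (multiple≅0 (+ b)))

-- Hamiltonian cycle systems from periodic walks

injective⇒surjective : ∀ {K} (f : Fin K → Fin K) → (∀ {x y} → f x ≡ f y → x ≡ y) → ∀ y → ∃ λ x → f x ≡ y
injective⇒surjective {suc K} f inj y with Finₚ.any? (λ x → f x Fin.≟ y)
... | yes p = p
... | no ¬p = ⊥-elim (ℕₚ.1+n≰n (Finₚ.injective⇒≤ {f = g} λ {x} {x′} e → inj
    (Finₚ.punchOut-injective (y≢f x) (y≢f x′) e)))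
  where
  y≢f : ∀ x → y ≢ f x
  y≢f x e = ¬p (x , sym e)
  g : Fin (suc K) → Fin K
  g x = Fin.punchOut (y≢f x)

opaque
  -- The only walk that agrees with `w₀` on 0, ..., r - 1 and satisfies w(i + r) = w(i) + r.
  extend : (r : ℕ) .{{_ : NonZero r}} → (ℕ → ℤ) → ℕ → ℤ
  extend r w₀ i = w₀ (i % r) + (+ i - + (i % r))

module Extend (r : ℕ) .{{_ : NonZero r}} (w₀ : ℕ → ℤ) where

  w : ℕ → ℤ
  w = extend r w₀

  opaque
    unfolding extend

    w-< : ∀ {i} → i < r → w i ≡ w₀ i
    w-< {i} i<r = trans (cong (λ j → w₀ j + (+ i - + j)) (ℕᵈ.m<n⇒m%n≡m i<r)) (lem (w₀ i) (+ i))
      where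
      lem : ∀ u v → u + (v - v) ≡ u
      lem = solve-∀

    w-+* : ∀ i k → w (i ℕ.+ k ℕ.* r) ≡ w i + + (k ℕ.* r)
    w-+* i k = trans (cong (λ j → w₀ j + (+ (i ℕ.+ k ℕ.* r) - + j)) (ℕᵈ.[m+kn]%n≡m%n i k r))
        (lem (w₀ (i % r)) (+ i) (+ (i % r)) (+ (k ℕ.* r)))
      where
      lem : ∀ u v t s → u + ((v + s) - t) ≡ u + (v - t) + s
      lem = solve-∀

    w-+ : ∀ {M} i → r ∣ M → w (i ℕ.+ M) ≡ w i + + M
    w-+ i (divides k refl) = w-+* i k

    w≅w₀ : ∀ i → w i ≅ w₀ (i % r) [ r ]
    w≅w₀ i = ≅-via (≅-sym (%-≅ i)) (lem (w₀ (i % r)) (+ i) (+ (i % r)))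
      where
      lem : ∀ u v t → (u + (v - t)) - u ≡ v - t
      lem = solve-∀

    -- Congruence modulo `r` already forces `i % r ≡ j % r`, and then the values differ by exactly i
    -- - j. So `N` consecutive values are distinct modulo `N`.
    w-injective : (∀ i j → i < r → j < r → w₀ i ≅ w₀ j [ r ] → i ≡ j) →
      ∀ {N} → r ∣ N → ∀ i j → w i ≅ w j [ N ] → + i ≅ + j [ N ]
    w-injective inj r∣N i j p = ≅-via p (trans (lem (w₀ (i % r)) (+ (i % r)) (+ i) (+ j))
      (cong (λ k → (w₀ (i % r) + (+ i - + (i % r))) - (w₀ k + (+ j - + k))) i%≡j%))
      where
      i%≡j% : i % r ≡ j % r
      i%≡j% = inj _ _ (ℕᵈ.m%n<n i r) (ℕᵈ.m%n<n j r)
          (≅-trans (≅-sym (w≅w₀ i)) (≅-trans (≅-weaken r∣N p) (w≅w₀ j)))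
      lem : ∀ u t x y → x - y ≡ (u + (x - t)) - (u + (y - t))
      lem = solve-∀

  w-step-% : ∀ i → w (suc i) - w i ≡ w (suc (i % r)) - w (i % r)
  w-step-% i = trans (cong₂ _-_ (trans (cong (w ∘ suc) i≡) (w-+* (suc (i % r)) (i / r)))
      (trans (cong w i≡) (w-+* (i % r) (i / r))))
    (lem (w (suc (i % r))) (w (i % r)) (+ (i / r ℕ.* r)))
    where
    i≡ : i ≡ i % r ℕ.+ i / r ℕ.* r
    i≡ = ℕᵈ.m≡m%n+[m/n]*n i r
    lem : ∀ x y t → (x + t) - (y + t) ≡ x - y
    lem = solve-∀

  step-inner : ∀ {i} → suc i < r → w (suc i) - w i ≡ w₀ (suc i) - w₀ i
  step-inner {i} si<r = cong₂ _-_ (w-< si<r) (w-< (ℕₚ.<-trans (ℕₚ.n<1+n i) si<r))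

  step-last : ∀ {i} → suc i ≡ r → w (suc i) - w i ≡ w₀ 0 + + r - w₀ i
  step-last {i} e = cong₂ _-_ (trans (cong w e) (trans (w-+ 0 (divides 1 (sym (ℕₚ.*-identityˡ r))))
    (cong (λ z → z + + r) (w-< (subst (0 <_) e (s≤s z≤n)))))) (w-< (ℕₚ.≤-reflexive e))

module FromWalks (m′ b : ℕ) where

  private
    m n N K : ℕ
    m = suc m′
    n = b ℕ.+ b
    N = m ℕ.* n
    K = b ℕ.* m′

  N≡ : N ≡ b ℕ.* m ℕ.+ b ℕ.* m
  N≡ = trans (ℕₚ.*-comm m n) (ℕₚ.*-distribʳ-+ m b b)

  open Classes m′ b N N≡

  module System
    (3≤N : 3 ≤ N)
    (Base : Set) (r : Base → ℕ) (r≢0 : ∀ β → NonZero (r β)) (r∣m : ∀ β → r β ∣ m)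
    (w₀ : Base → ℕ → ℤ)
    (w₀-injective : ∀ β i j → i < r β → j < r β → w₀ β i ≅ w₀ β j [ r β ] → i ≡ j)
    (decode : Fin K → Σ Base (Fin ∘ r)) (encode : Σ Base (Fin ∘ r) → Fin K)
    (decode∘encode : ∀ z → decode (encode z) ≡ z) (encode∘decode : ∀ j → encode (decode j) ≡ j)
    where

    w : Base → ℕ → ℤ
    w β = extend (r β) {{r≢0 β}} (w₀ β)

    -- Used in two roles: (β, s) is the step of the walk β after index s, and it is also the cycle
    -- obtained by translating that walk by s. Hence the number of cycles equals the number of
    -- steps, which `decode` and `encode` identify with the number `K` of classes.
    Position : Set
    Position = Σ Base (Fin ∘ r)

    stepAt : Position → ℤ
    stepAt (β , s) = w β (suc (toℕ s)) - w β (toℕ s)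

    module _
      .{{N≢0 : NonZero N}}
      (hit : Fin b → Fin m′ → Position)
      (hit-step : ∀ q ρ → stepAt (hit q ρ) ≅± rep q ρ [ N ])
      where

      private
        module E (β : Base) = Extend (r β) {{r≢0 β}} (w₀ β)

        r∣N : ∀ β → r β ∣ N
        r∣N β = ∣-trans (r∣m β) m∣N

      hitᶠ : Fin K → Fin K
      hitᶠ f = encode (hit (proj₁ (remQuot {b} m′ f)) (proj₂ (remQuot {b} m′ f)))

      encode-injective : ∀ {z z′} → encode z ≡ encode z′ → z ≡ z′
      encode-injective e = trans (sym (decode∘encode _)) (trans (cong decode e) (decode∘encode _))

      hit-injective : ∀ {q q′ ρ ρ′} → hit q ρ ≡ hit q′ ρ′ → (q , ρ) ≡ (q′ , ρ′)
      hit-injective {q} {q′} {ρ} {ρ′} e = rep-injective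
        (±-trans (±-sym (hit-step q ρ)) (subst (λ z → stepAt z ≅± rep q′ ρ′ [ N ]) (sym e)
            (hit-step q′ ρ′)))

      hitᶠ-injective : ∀ {f f′} → hitᶠ f ≡ hitᶠ f′ → f ≡ f′
      hitᶠ-injective {f} {f′} e = trans (sym (Finₚ.combine-remQuot {b} m′ f))
        (trans (cong (λ z → combine (proj₁ z) (proj₂ z)) (hit-injective (encode-injective e)))
            (Finₚ.combine-remQuot {b} m′ f′))

      hit-surjective : ∀ z → ∃ λ q → ∃ λ ρ → hit q ρ ≡ z
      hit-surjective z = let f , e = injective⇒surjective hitᶠ hitᶠ-injective (encode z) in _ , _ , encode-injective e

      stepAt-injective : ∀ {z z′} → stepAt z ≅± stepAt z′ [ N ] → z ≡ z′
      stepAt-injective {z} {z′} p with hit-surjective z | hit-surjective z′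
      ... | q , ρ , refl | q′ , ρ′ , refl = cong (λ x → hit (proj₁ x) (proj₂ x))
        (rep-injective (±-trans (±-sym (hit-step q ρ)) (±-trans p (hit-step q′ ρ′))))

      -- Adjacency comes from the surjectivity of `hit`: every step of every walk is, up to sign, a
      -- representative, and no representative is a multiple of `m`.
      step≇0 : ∀ β i → ¬ (w β i ≅ w β (suc i) [ m ])
      step≇0 β i p with hit-surjective (β , Fin.fromℕ< (ℕᵈ.m%n<n i (r β) {{r≢0 β}}))
      ... | q , ρ , e = rep≇0 q ρ (±0 (±-trans (≅±-weaken (±-sym (hit-step q ρ))) (inj₁ s≅0)))
        where
        ±0 : ∀ {x} → x ≅± + 0 [ m ] → x ≅ + 0 [ m ]
        ±0 (inj₁ p) = p
        ±0 (inj₂ p) = p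
        ≅±-weaken : ∀ {x y} → x ≅± y [ N ] → x ≅± y [ m ]
        ≅±-weaken = Sum.map (≅-weaken m∣N) (≅-weaken m∣N)
        s≡ : stepAt (hit q ρ) ≡ w β (suc i) - w β i
        s≡ = trans (cong stepAt e) (trans (cong (λ k → w β (suc k) - w β k) (Finₚ.toℕ-fromℕ< _))
            (sym (E.w-step-% β i)))
        lem : ∀ u v → (u - v) - + 0 ≡ u - v
        lem = solve-∀
        s≅0 : stepAt (hit q ρ) ≅ + 0 [ m ]
        s≅0 = ≅-trans (≅-reflexive s≡) (≅-via (≅-sym p) (lem (w β (suc i)) (w β i)))

      walk : Position → ℕ → ℤ
      walk (β , s) i = w β i + + toℕ s

      cycle : Position → ℕ → ℕ
      cycle z i = walk z i %ℕ N

      w-%N : ∀ β i → w β i ≅ w β (i % N) [ N ]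
      w-%N β i = ≅-trans (≅-reflexive (trans (cong (w β) i≡)
          (E.w-+ β (i % N) (∣-trans (r∣N β) (divides (i / N) refl)))))
        (≅-trans (≅-reflexive (cong (λ z → w β (i % N) + z) (ℤₚ.pos-* (i / N) N)))
            (+multiple-≅ _ (+ (i / N))))
        where
        i≡ : i ≡ i % N ℕ.+ i / N ℕ.* N
        i≡ = ℕᵈ.m≡m%n+[m/n]*n i N

      cycle-Lift : ∀ z → Lift N (cycle z) (walk z)
      range (cycle-Lift z) i _ = n%ℕd<d (walk z i) N
      lift (cycle-Lift z@(β , s)) i = ≅-trans (+-≅ (w-%N β i) ≅-refl) (≅-sym (%ℕ-≅ (walk z (i % N))))

      cycle-adjacent : ∀ z i j → walk z (suc i) ≅ walk z j [ N ] → Adj m (cycle z i) (cycle z j)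
      cycle-adjacent z@(β , s) i j e = ≇⇒Adj m λ p → step≇0 β i (+-cancelʳ-≅ (+ toℕ s)
        (≅-trans (≅-weaken m∣N (≅-sym (%ℕ-≅ (walk z i))))
            (≅-trans p (≅-weaken m∣N (≅-trans (%ℕ-≅ (walk z j)) (≅-sym e))))))

      cycle-hamiltonian : ∀ z → HamCycle m n (cycle z)
      cycle-hamiltonian z@(β , s) = record
        { length≥3  = 3≤N
        ; inRange   = λ i _ → n%ℕd<d (walk z i) N
        ; injective = λ i j i<N j<N e → ≅⇒≡ i<N j<N (E.w-injective β (w₀-injective β) (r∣N β) i j
            (+-cancelʳ-≅ (+ toℕ s) (≅-trans (≅-sym (%ℕ-≅ (walk z i)))
                (≅-trans (≅-reflexive (cong +_ e)) (%ℕ-≅ (walk z j))))))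
        ; adjacent  = λ i _ → cycle-adjacent z i (suc i) ≅-refl
        ; closing   = cycle-adjacent z (N ℕ.∸ 1) 0 (≅-trans (lift (cycle-Lift z) (suc (N ℕ.∸ 1)))
            (≅-trans (≅-reflexive (cong (+_ ∘ cycle z)
                (trans (cong (_% N) (ℕₚ.suc-pred N)) (ℕᵈ.n%n≡0 N)))) (%ℕ-≅ (walk z 0))))
        }

      -- Divide x - w(i₀) by r, with remainder s and quotient k: the remainder selects the
      -- translate, and going k periods along the walk supplies the multiple of r. The quotient may
      -- be negative, so it is replaced by its residue modulo `N`.
      Step-exists : ∀ z x y .{{_ : NonZero (r (proj₁ z))}} → stepAt z ≅ y - x [ N ] → ∃ λ s → Step N
          (walk (proj₁ z , s)) x y
      Step-exists z@(β , p) x y {{r′≢0}} e = s , step i sx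
          (≅-via (+-≅ sx e) (trans (lem₂ (w β (suc i)) (w β i) (+ toℕ s) x y)
          (cong (λ d → (w β i + + toℕ s + d) - (x + (y - x))) st)))
        where
        i₀ = toℕ p
        δ : ℤ
        δ = x - w β i₀
        s : Fin (r β)
        s = fromℕ< (n%ℕd<d δ (r β))
        k = δ /ℕ r β
        i = i₀ ℕ.+ (k %ℕ N) ℕ.* r β
        lem : ∀ a b k k′ c d e → a - b ≡ c + k * d → e ≡ (k′ - k) * d → ((b + k′ * d) + c) - a ≡ e
        lem a b k k′ c d e h refl = trans (l₁ a b k′ c d)
            (trans (cong (λ z → k′ * d + c - z) h) (l₂ k k′ c d))
          where
          l₁ : ∀ a b k′ c d → ((b + k′ * d) + c) - a ≡ k′ * d + c - (a - b)
          l₁ = solve-∀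
          l₂ : ∀ k k′ c d → k′ * d + c - (c + k * d) ≡ (k′ - k) * d
          l₂ = solve-∀
        k≅ : (+ (k %ℕ N) - k) * + r β ≅ + 0 [ N ]
        k≅ = ≅-trans (≅-reflexive (ℤₚ.*-comm (+ (k %ℕ N) - k) (+ r β)))
               (≅-trans (*-≅ (+ r β) (≅-via (%ℕ-≅ k) (lem₀ (+ (k %ℕ N)) k)))
                   (≅-reflexive (ℤₚ.*-zeroʳ (+ r β))))
          where
          lem₀ : ∀ u v → (u - v) - + 0 ≡ u - v
          lem₀ = solve-∀
        sx : walk (β , s) i ≅ x [ N ]
        sx = ≅-via k≅ (trans (cong (λ z → z + + toℕ s - x)
            (trans (E.w-+* β i₀ (k %ℕ N)) (cong (λ z → w β i₀ + z) (ℤₚ.pos-* (k %ℕ N) (r β)))))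
               (lem x (w β i₀) k (+ (k %ℕ N)) (+ toℕ s) (+ r β) _
                 (trans (a≡a%ℕn+[a/ℕn]*n δ (r β)) (cong (λ j → + j + k * + r β) (sym (Finₚ.toℕ-fromℕ< _))))
                 (ℤₚ.+-identityʳ _)))
        lem₂ : ∀ u v s x y → (u + s) - y ≡ (v + s + (u - v)) - (x + (y - x))
        lem₂ = solve-∀
        st : w β (suc i) - w β i ≡ stepAt z
        st = trans (cong₂ _-_ (E.w-+* β (suc i₀) (k %ℕ N)) (E.w-+* β i₀ (k %ℕ N)))
            (lem₁ (w β (suc i₀)) (w β i₀) _)
          where
          lem₁ : ∀ x y t → (x + t) - (y + t) ≡ x - y
          lem₁ = solve-∀

      covered : ∀ x y → ¬ (x ≅ y [ m ]) → ∃ λ z → Link N (walk z) x y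
      covered x y x≇y with rep-surjective (y - x) (λ p → x≇y (≅-via⁻ p (lem y x)))
        where
        lem : ∀ y x → x - y ≡ + 0 - (y - x)
        lem = solve-∀
      ... | q , ρ , p with ±-trans (hit-step q ρ) (±-sym p)
      ... | inj₁ e = let s , t = Step-exists (hit q ρ) x y {{r≢0 _}} e in (proj₁ (hit q ρ) , s) , inj₁ t
      ... | inj₂ e = let s , t = Step-exists (hit q ρ) y x {{r≢0 _}} (≅-trans e (≅-reflexive (lem y x))) in (proj₁ (hit q ρ) , s) , inj₂ t
        where
        lem : ∀ y x → - (y - x) ≡ x - y
        lem = solve-∀

      -- Recovers the cycle from the edge: the difference y - x determines the position (β, p), and
      -- after that the residue of x modulo `r β` determines the translate s.
      Step⇒stepAt : ∀ {β s x y} .{{_ : NonZero (r β)}} → Step N (walk (β , s)) x y →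
        ∃ λ (p : Fin (r β)) → stepAt (β , p) ≅ y - x [ N ] × w β (toℕ p) + + toℕ s ≅ x [ r β ]
      Step⇒stepAt {β} {s} {x} {y} {{r′≢0}} (step i sx sy) = p , ≅-via (minus-≅ sy sx)
          (cong (λ z → z - (y - x)) d) ,
        ≅-trans (+-≅ (≅-trans (E.w≅w₀ β (toℕ p)) (≅-trans (≅-reflexive (cong (w₀ β) p%))
            (≅-sym (E.w≅w₀ β i)))) ≅-refl) (≅-weaken (r∣N β) sx)
        where
        p : Fin (r β)
        p = fromℕ< (ℕᵈ.m%n<n i (r β))
        p≡ : toℕ p ≡ i % r β
        p≡ = Finₚ.toℕ-fromℕ< _
        p% : toℕ p % r β ≡ i % r β
        p% = trans (cong (_% r β) p≡) (ℕᵈ.m%n%n≡m%n i (r β))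
        lem : ∀ u v s → u - v ≡ (u + s) - (v + s)
        lem = solve-∀
        d : stepAt (β , p) ≡ walk (β , s) (suc i) - walk (β , s) i
        d = trans (cong (λ k → w β (suc k) - w β k) p≡)
            (trans (sym (E.w-step-% β i)) (lem (w β (suc i)) (w β i) (+ toℕ s)))

      Step-unique : ∀ {z z′ x y} → Step N (walk z) x y → Step N (walk z′) x y → z ≡ z′
      Step-unique {β , s} {β′ , s′} {x} {y} t t′ =
        let p , e , f = Step⇒stepAt {s = s} {{r≢0 β}} t
            p′ , e′ , f′ = Step⇒stepAt {s = s′} {{r≢0 β′}} t′
        in translate≡ (stepAt-injective {β , p} {β′ , p′} (inj₁ (≅-trans e (≅-sym e′)))) f f′
        where
        translate≡ : ∀ {β β′ p p′ s s′} → (β , p) ≡ (β′ , p′) →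
          w β (toℕ p) + + toℕ s ≅ x [ r β ] → w β′ (toℕ p′) + + toℕ s′ ≅ x [ r β′ ] → (β , s) ≡ (β′ , s′)
        translate≡ {β} {p = p} {s = s} {s′} refl f f′ = cong (β ,_) (Finₚ.toℕ-injective
          (≅⇒≡ (Finₚ.toℕ<n s) (Finₚ.toℕ<n s′) (+-cancelˡ-≅ (w β (toℕ p)) (≅-trans f (≅-sym f′)))))

      stepAt≇-stepAt : ∀ z → ¬ (stepAt z ≅ - stepAt z [ N ])
      stepAt≇-stepAt z S≅-S = let q , ρ , h = hit-surjective z in
        rep≇-rep q ρ q ρ ([ direct , reversed ]′ (subst (λ z → stepAt z ≅± rep q ρ [ N ]) h (hit-step q ρ)))
        where
        direct : ∀ {x} → stepAt z ≅ x [ N ] → x ≅ - x [ N ]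
        direct d = ≅-trans (≅-sym d) (≅-trans S≅-S (neg-≅ d))
        reversed : ∀ {x} → stepAt z ≅ - x [ N ] → x ≅ - x [ N ]
        reversed {x} d = ≅-trans (≅-reflexive (sym (ℤₚ.neg-involutive x)))
            (≅-trans (neg-≅ (≅-sym d)) (≅-trans (≅-sym S≅-S) d))

      -- Opposite traversals of an edge have steps d and -d. These belong to one class, hence to one
      -- position, and d ≅ -d is impossible for a representative.
      Step-oriented : ∀ {z z′ x y} → Step N (walk z) x y → ¬ Step N (walk z′) y x
      Step-oriented {β , s} {β′ , s′} {x} {y} t t′ =
        let p , e , _ = Step⇒stepAt {s = s} {{r≢0 β}} t
            p′ , e′ , _ = Step⇒stepAt {s = s′} {{r≢0 β′}} t′
            opposite-steps = ≅-trans e (≅-trans (≅-reflexive (lem y x)) (neg-≅ (≅-sym e′)))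
        in stepAt≇-stepAt (β , p) (subst (λ z → stepAt (β , p) ≅ - stepAt z [ N ])
             (sym (stepAt-injective {β , p} {β′ , p′} (inj₂ opposite-steps))) opposite-steps)
        where
        lem : ∀ y x → y - x ≡ - (x - y)
        lem = solve-∀

      Link-unique : ∀ {z z′ x y} → Link N (walk z) x y → Link N (walk z′) x y → z ≡ z′
      Link-unique {z} {z′} (inj₁ t) (inj₁ t′) = Step-unique {z} {z′} t t′
      Link-unique {z} {z′} (inj₁ t) (inj₂ t′) = ⊥-elim (Step-oriented {z} {z′} t t′)
      Link-unique {z} {z′} (inj₂ t) (inj₁ t′) = ⊥-elim (Step-oriented {z} {z′} t t′)
      Link-unique {z} {z′} (inj₂ t) (inj₂ t′) = Step-unique {z} {z′} t t′

      -- The translation acts as a shift of the index by `M`. The shift by `N ∸ M` inverts it, since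
      -- `N` steps of a walk add `N` and so lead back to the same vertex.
      translate-SameCycle : ∀ {z z′ M} k → r (proj₁ z′) ∣ M → M ≤ N →
          (∀ i → walk z i + + k ≡ walk z′ (i ℕ.+ M)) →
        SameCycle N (cycle z′) (shift N k (cycle z))
      translate-SameCycle {z} {z′} {M} k r∣M M≤N e = SameCycle-from-Links (cycle-Lift z′)
          (shift-Lift k (cycle-Lift z))
        (λ x y → Link-map (λ i → i ℕ.+ (N ℕ.∸ M)) λ i → back i (i ℕ.+ (N ℕ.∸ M)) refl , back (suc i)
            (suc i ℕ.+ (N ℕ.∸ M)) refl)
        (λ x y → Link-map (λ i → i ℕ.+ M) λ i → ≅-reflexive (sym (e i)) , ≅-reflexive (sym (e (suc i))))
        where
        back : ∀ i j → j ≡ i ℕ.+ (N ℕ.∸ M) → walk z j + + k ≅ walk z′ i [ N ]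
        back i j refl = ≅-trans (≅-reflexive (trans (e j)
            (cong (walk z′) (trans (ℕₚ.+-assoc i (N ℕ.∸ M) M) (cong (i ℕ.+_) (ℕₚ.m∸n+n≡m M≤N))))))
          (+-≅ (≅-trans (≅-reflexive (trans (E.w-+ (proj₁ z′) i (r∣N (proj₁ z′)))
              (cong (λ x → w (proj₁ z′) i + x) (sym (ℤₚ.*-identityˡ (+ N))))))
              (+multiple-≅ (w (proj₁ z′) i) (+ 1))) ≅-refl)

      -- After s = r - 1 comes s = 0: a translation by r only advances the walk by one period.
      next : Position → Position
      next (β , s) with suc (toℕ s) ℕ.<? r β
      ... | yes p = β , fromℕ< p
      ... | no _  = β , fromℕ< (ℕₚ.≤-<-trans z≤n (Finₚ.toℕ<n s))

      next-SameCycle : ∀ z → SameCycle N (cycle (next z)) (shift N 1 (cycle z))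
      next-SameCycle (β , s) with suc (toℕ s) ℕ.<? r β
      ... | yes p = translate-SameCycle {β , s} {β , fromℕ< p} {0} 1 (divides 0 refl) z≤n λ i →
        trans (lem (w β i) (+ toℕ s)) (cong₂ (λ j k → w β j + + k) (sym (ℕₚ.+-identityʳ i))
            (sym (Finₚ.toℕ-fromℕ< p)))
        where
        lem : ∀ u v → u + v + + 1 ≡ u + (+ 1 + v)
        lem = solve-∀
      ... | no ¬p = translate-SameCycle {β , s} {β , fromℕ< 0<r} {r β} 1
          (divides 1 (sym (ℕₚ.*-identityˡ _))) (∣⇒≤ (r∣N β)) λ i →
        trans (lem (w β i) (+ toℕ s)) (trans (cong (λ k → w β i + + k) s≡)
          (trans (sym (E.w-+ β i (divides 1 (sym (ℕₚ.*-identityˡ _)))))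
              (trans (sym (ℤₚ.+-identityʳ _)) (cong (λ k → w β (i ℕ.+ r β) + + k)
              (sym (Finₚ.toℕ-fromℕ< 0<r))))))
        where
        0<r : 0 < r β
        0<r = ℕₚ.≤-<-trans z≤n (Finₚ.toℕ<n s)
        s≡ : suc (toℕ s) ≡ r β
        s≡ = ℕₚ.≤-antisym (Finₚ.toℕ<n s) (ℕₚ.≮⇒≥ ¬p)
        lem : ∀ u v → u + v + + 1 ≡ u + (+ 1 + v)
        lem = solve-∀

      m-SameCycle : ∀ z → SameCycle N (cycle z) (shift N m (cycle z))
      m-SameCycle z@(β , s) = translate-SameCycle {z} {z} {m} m (r∣m β) (∣⇒≤ m∣N) λ i →
        trans (lem (w β i) (+ toℕ s) (+ m)) (cong (λ x → x + + toℕ s) (sym (E.w-+ β i (r∣m β))))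
        where
        lem : ∀ u v t → u + v + t ≡ u + t + v
        lem = solve-∀

      system : CyclicSymHCSExists m n
      system = K , (λ j → cycle (decode j)) , hcs , cyclic , symmetric
        where
        hcs : HCS m n K (λ j → cycle (decode j))
        hcs = record
          { hamiltonian = λ j → cycle-hamiltonian (decode j)
          ; partition   = λ x y x<N y<N adj → let z , l = covered (+ x) (+ y) (Adj⇒≇ m adj) in
              encode z ,
              subst (λ z → InCycle N (cycle z) x y) (sym (decode∘encode z))
                  (Link⇒InCycle (cycle-Lift z) x<N y<N l) ,
              λ j p → trans (sym (encode∘decode j))
                (cong encode (Link-unique {decode j} {z} (InCycle⇒Link (cycle-Lift (decode j)) p) l))
          }
        cyclic : Cyclic m n K (λ j → cycle (decode j))
        cyclic j = encode (next (decode j)) , subst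
            (λ z → SameCycle N (cycle z) (shift N 1 (cycle (decode j))))
          (sym (decode∘encode (next (decode j)))) (next-SameCycle (decode j))
        symmetric : PhiSymmetric m n K (λ j → cycle (decode j))
        symmetric j x y = let e = m-SameCycle (decode j) x y in mk⇔ (Equivalence.from e) (Equivalence.to e)

-- Zigzag walks

even : ℕ → Bool
even zero    = true
even (suc i) = not (even i)

data Halves : ℕ → Set where
  double  : ∀ k → Halves (k ℕ.+ k)
  double+1 : ∀ k → Halves (suc (k ℕ.+ k))

halves : ∀ i → Halves i
halves zero = double 0
halves (suc i) with halves i
... | double k   = double+1 k
... | double+1 k = subst Halves (cong suc (ℕₚ.+-suc k k)) (double (suc k))

halve-< : ∀ {i j} → i ℕ.+ i < j ℕ.+ j → i < j
halve-< {i} {j} p with i ℕ.<? j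
... | yes q = q
... | no ¬q = ⊥-elim (ℕₚ.<⇒≱ p (ℕₚ.+-mono-≤ (ℕₚ.≮⇒≥ ¬q) (ℕₚ.≮⇒≥ ¬q)))

even-+ : ∀ i j → even (i ℕ.+ j) ≡ (if even i then even j else not (even j))
even-+ zero j = refl
even-+ (suc i) j with even i | even-+ i j
... | true  | e = cong not e
... | false | e = trans (cong not e) (not-involutive (even j))

even-double : ∀ k → even (k ℕ.+ k) ≡ true
even-double k with even k in e
... | true  = trans (even-+ k k) (trans (cong (λ b → if b then even k else not (even k)) e) e)
... | false = trans (even-+ k k) (trans (cong (λ b → if b then even k else not (even k)) e) (cong not e))

even⇒≅0 : ∀ i → even i ≡ true → + i ≅ + 0 [ 2 ]
even⇒≅0 i e with halves i
... | double k = by (+ k) (lem (+ k))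
  where
  lem : ∀ k → k + k ≡ + 0 + k * + 2
  lem = solve-∀
... | double+1 k = case trans (sym e) (cong not (even-double k)) of λ ()

odd⇒≅1 : ∀ i → even i ≡ false → + i ≅ + 1 [ 2 ]
odd⇒≅1 i e with halves i
... | double+1 k = by (+ k) (lem (+ k))
  where
  lem : ∀ k → + 1 + (k + k) ≡ + 1 + k * + 2
  lem = solve-∀
... | double k = case trans (sym e) (even-double k) of λ ()

0≇1 : ¬ (+ 0 ≅ + 1 [ 2 ])
0≇1 p = case ≅⇒≡ (s≤s z≤n) (s≤s (s≤s z≤n)) p of λ ()

-- The values are 0, -(qm + 2), 2, -(qm + 4), 4, .... The steps alternate in sign, and the one after
-- index i has absolute value qm + 2(i + 1).
zig : (m q i : ℕ) → ℤ
zig m q i = if even i then + i else - (+ q * + m + + suc i)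

zig-step : ∀ m q i → let d = + q * + m + + suc (suc (i ℕ.+ i)) in zig m q (suc i) - zig m q i ≡ d ⊎ zig m q (suc i) - zig m q i ≡ - d
zig-step m q i with even i
... | true  = inj₂ (lem (+ q * + m) (+ i))
  where
  lem : ∀ x i → - (x + (+ 2 + i)) - i ≡ - (x + (+ 2 + (i + i)))
  lem = solve-∀
... | false = inj₁ (lem (+ q * + m) (+ i))
  where
  lem : ∀ x i → (+ 1 + i) - (- (x + (+ 1 + i))) ≡ x + (+ 2 + (i + i))
  lem = solve-∀

zig-even : ∀ m q i → even i ≡ true → zig m q i ≡ + i
zig-even m q i e rewrite e = refl

zig-odd : ∀ m q i → even i ≡ false → zig m q i ≡ - (+ q * + m + + suc i)
zig-odd m q i e rewrite e = refl

module _ (h : ℕ) where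
  private
    m : ℕ
    m = h ℕ.+ h

    2∣m : 2 ∣ m
    2∣m = divides h (lem h)
      where
      lem : ∀ h → h ℕ.+ h ≡ h ℕ.* 2
      lem = ℕS.solve-∀

  zig≅0 : ∀ q i → zig m q i ≅ + 0 [ 2 ]
  zig≅0 q i with even i in e
  ... | true  = even⇒≅0 i e
  ... | false = ≅-trans (neg-≅ (+-≅ (*-≅ (+ q) (≅-weaken 2∣m m≅0)) (even⇒≅0 (suc i) (cong not e))))
      (≅-reflexive (lem (+ q)))
    where
    m≅0 : + m ≅ + 0 [ m ]
    m≅0 = by (+ 1) (lem₀ (+ m))
      where
      lem₀ : ∀ m → m ≡ + 0 + + 1 * m
      lem₀ = solve-∀
    lem : ∀ q → - (q * + 0 + + 0) ≡ + 0
    lem = solve-∀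

  -- For i even and j odd, zig i and zig j agree modulo r only if r divides i + j + 1, which is even and
  -- lies strictly between 0 and 2h; this excludes r = 2h, and r = h for h odd.
  private
    zig-injective′ : ∀ r q → r ∣ m → h ≤ r → (∀ i j → i < h → j < h → even i ≡ true → even j ≡ false → ¬
        (+ (i ℕ.+ suc j) ≅ + 0 [ r ])) →
      ∀ i j → i < h → j < h → zig m q i ≅ zig m q j [ r ] → i ≡ j
    zig-injective′ r q r∣m h≤r mixed i j i<h j<h p with even i in ei | even j in ej
    ... | true  | true  = ≅⇒≡ (ℕₚ.<-≤-trans i<h h≤r) (ℕₚ.<-≤-trans j<h h≤r) p
    ... | false | false = ≅⇒≡ (ℕₚ.<-≤-trans i<h h≤r) (ℕₚ.<-≤-trans j<h h≤r)
        (≅-via⁻ p (lem (+ q * + m) (+ i) (+ j)))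
      where
      lem : ∀ x i j → i - j ≡ - (x + (+ 1 + j)) - - (x + (+ 1 + i))
      lem = solve-∀
    ... | true  | false = ⊥-elim (mixed i j i<h j<h ei ej
        (≅-trans (≅-via p (lem (+ q * + m) (+ i) (+ j))) qm≅0))
      where
      lem : ∀ x i j → (i + (+ 1 + j)) - (- x) ≡ i - - (x + (+ 1 + j))
      lem = solve-∀
      qm≅0 : - (+ q * + m) ≅ + 0 [ r ]
      qm≅0 = neg-≅ (≅-weaken r∣m (multiple≅0 (+ q)))
    ... | false | true = ⊥-elim (mixed j i j<h i<h ej ei
        (≅-trans (≅-via⁻ p (lem (+ q * + m) (+ i) (+ j))) qm≅0))
      where
      lem : ∀ x i j → (j + (+ 1 + i)) - (- x) ≡ j - - (x + (+ 1 + i))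
      lem = solve-∀
      qm≅0 : - (+ q * + m) ≅ + 0 [ r ]
      qm≅0 = neg-≅ (≅-weaken r∣m (multiple≅0 (+ q)))

  zig-injective : ∀ q i j → i < h → j < h → zig m q i ≅ zig m q j [ m ] → i ≡ j
  zig-injective q = zig-injective′ m q (divides 1 (sym (ℕₚ.*-identityˡ m))) (ℕₚ.m≤m+n h h) λ i j i<h j<h _
      _ p →
    case trans (sym (ℕₚ.+-suc i j)) (≅⇒≡ (ℕₚ.+-mono-<-≤ i<h j<h)
        (ℕₚ.≤-<-trans z≤n (ℕₚ.+-mono-<-≤ i<h j<h)) p) of λ ()

  zig-injective-half : even h ≡ false → ∀ q i j → i < h → j < h → zig m q i ≅ zig m q j [ h ] → i ≡ j
  zig-injective-half h-odd q = zig-injective′ h q (divides 2 (lem h)) ℕₚ.≤-refl mixed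
    where
    lem : ∀ h → h ℕ.+ h ≡ 2 ℕ.* h
    lem = ℕS.solve-∀
    mixed : ∀ i j → i < h → j < h → even i ≡ true → even j ≡ false → ¬ (+ (i ℕ.+ suc j) ≅ + 0 [ h ])
    mixed i j i<h j<h ei ej p with i ℕ.+ suc j ℕ.<? h
    ... | yes s<h = case trans (sym (ℕₚ.+-suc i j)) (≅⇒≡ s<h (ℕₚ.≤-<-trans z≤n i<h) p) of λ ()
    ... | no s≮h = case trans (sym even-s) (trans (cong even s≡h) h-odd) of λ ()
      where
      s = i ℕ.+ suc j
      even-s : even s ≡ true
      even-s = trans (even-+ i (suc j)) (trans (cong
          (λ b → if b then even (suc j) else not (even (suc j))) ei) (cong not ej))
      s∸h+h : s ℕ.∸ h ℕ.+ h ≡ s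
      s∸h+h = ℕₚ.m∸n+n≡m (ℕₚ.≮⇒≥ s≮h)
      lem₂ : ∀ x h → x - + 0 ≡ (x + h) - (+ 0 + h)
      lem₂ = solve-∀
      s∸h<h : s ℕ.∸ h < h
      s∸h<h = ℕₚ.+-cancelʳ-< h (s ℕ.∸ h) h (subst (_< h ℕ.+ h) (sym s∸h+h) (ℕₚ.+-mono-<-≤ i<h j<h))
      h≅0 : + 0 + + h ≅ + 0 [ h ]
      h≅0 = by (+ 1) (cong (λ z → + 0 + z) (sym (ℤₚ.*-identityˡ (+ h))))
      s∸h≡0 : s ℕ.∸ h ≡ 0
      s∸h≡0 = ≅⇒≡ s∸h<h (ℕₚ.≤-<-trans z≤n i<h) (≅-via
          (≅-trans (≅-reflexive (cong +_ s∸h+h)) (≅-trans p (≅-sym h≅0))) (lem₂ (+ (s ℕ.∸ h)) (+ h)))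
      s≡h : s ≡ h
      s≡h = trans (sym s∸h+h) (cong (ℕ._+ h) s∸h≡0)

-- The base walks

module Construction (h′ a ε t : ℕ) where

  private
    h m m′ b : ℕ
    h = suc h′
    m = h ℕ.+ h
    m′ = h′ ℕ.+ h
    b = a ℕ.+ (ε ℕ.+ a)

  -- There are n/2 = b rows: a lower, ε middle and a upper ones. The odd number `c l` moves the
  -- second zigzag of a long walk to the odd residues, `σ` is its sign, and `g k` is the odd vertex
  -- of a walk of period 2. `count` equates the number of steps with the number b(m - 1) of classes.
  module Walks
    (short⇒h-odd : Fin ε → even h ≡ false)
    (c : Fin a → ℤ) (c-odd : ∀ l → c l ≅ + 1 [ 2 ])
    (σ : ℤ) (σ≡±1 : σ ≡ + 1 ⊎ σ ≡ - (+ 1))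
    (g : Fin t → ℤ) (g-odd : ∀ k → g k ≅ + 1 [ 2 ])
    (3≤N : 3 ≤ m ℕ.* (b ℕ.+ b))
    (count : ε ℕ.* h ℕ.+ (a ℕ.* m ℕ.+ t ℕ.* 2) ≡ b ℕ.* (h′ ℕ.+ h))
    where

    Base : Set
    Base = Fin ε ⊎ (Fin a ⊎ Fin t)

    r : Base → ℕ
    r (inj₁ _)        = h
    r (inj₂ (inj₁ _)) = m
    r (inj₂ (inj₂ _)) = 2

    r≢0 : ∀ β → NonZero (r β)
    r≢0 (inj₁ _)        = _
    r≢0 (inj₂ (inj₁ _)) = _
    r≢0 (inj₂ (inj₂ _)) = _

    h+h≡h*2 : h ℕ.+ h ≡ h ℕ.* 2
    h+h≡h*2 = trans (cong (h ℕ.+_) (sym (ℕₚ.+-identityʳ h))) (ℕₚ.*-comm 2 h)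

    2∣m : 2 ∣ m
    2∣m = divides h h+h≡h*2

    r∣m : ∀ β → r β ∣ m
    r∣m (inj₁ _)        = divides 2 (trans h+h≡h*2 (ℕₚ.*-comm h 2))
    r∣m (inj₂ (inj₁ _)) = divides 1 (sym (ℕₚ.*-identityˡ m))
    r∣m (inj₂ (inj₂ _)) = 2∣m

    -- This is row b - 1 - l, so the outermost rows are joined by the walk 0 and the innermost ones
    -- by the last walk.
    upperRow : Fin a → ℕ
    upperRow l = a ℕ.+ (ε ℕ.+ toℕ (opposite l))

    -- The even residues are visited before index h, the odd ones after it. So the two odd steps are
    -- those after the indices h - 1 and 2h - 1, where the two zigzags end.
    long : Fin a → ℕ → ℤ
    long l i with i ℕ.<? h
    ... | yes _ = zig m (upperRow l) i
    ... | no _  = c l + σ * zig m (toℕ l) (i ℕ.∸ h)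

    long-low : ∀ l i → i < h → long l i ≡ zig m (upperRow l) i
    long-low l i i<h with i ℕ.<? h
    ... | yes _  = refl
    ... | no i≮h = ⊥-elim (i≮h i<h)

    long-high : ∀ l j → long l (h ℕ.+ j) ≡ c l + σ * zig m (toℕ l) j
    long-high l j with h ℕ.+ j ℕ.<? h
    ... | yes p = ⊥-elim (ℕₚ.<⇒≱ p (ℕₚ.m≤m+n h j))
    ... | no _  = cong (λ k → c l + σ * zig m (toℕ l) k) (ℕₚ.m+n∸m≡n h j)

    pair : Fin t → ℕ → ℤ
    pair k zero    = + 0
    pair k (suc _) = g k

    w₀ : Base → ℕ → ℤ
    w₀ (inj₁ e)        = zig m (a ℕ.+ toℕ e)
    w₀ (inj₂ (inj₁ l)) = long l
    w₀ (inj₂ (inj₂ k)) = pair k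

    data LowHigh : ℕ → Set where
      low  : ∀ {i} → i < h → LowHigh i
      high : ∀ {j} → j < h → LowHigh (h ℕ.+ j)

    lowHigh : ∀ i → i < m → LowHigh i
    lowHigh i i<m with i ℕ.<? h
    ... | yes p = low p
    ... | no ¬p = subst LowHigh e (high (ℕₚ.+-cancelˡ-< h (i ℕ.∸ h) h (subst (_< m) (sym e) i<m)))
      where
      e : h ℕ.+ (i ℕ.∸ h) ≡ i
      e = ℕₚ.m+[n∸m]≡n (ℕₚ.≮⇒≥ ¬p)

    σ²≡1 : σ * σ ≡ + 1
    σ²≡1 = [ (λ { refl → refl }) , (λ { refl → refl }) ]′ σ≡±1

    low≅0 : ∀ l i → i < h → long l i ≅ + 0 [ 2 ]
    low≅0 l i i<h = ≅-trans (≅-reflexive (long-low l i i<h)) (zig≅0 h (upperRow l) i)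

    high≅1 : ∀ l j → long l (h ℕ.+ j) ≅ + 1 [ 2 ]
    high≅1 l j = ≅-trans (≅-reflexive (long-high l j)) (≅-trans (+-≅ (c-odd l) (*-≅ σ (zig≅0 h (toℕ l) j)))
      (≅-reflexive (lem σ)))
      where
      lem : ∀ s → + 1 + s * + 0 ≡ + 1
      lem = solve-∀

    -- Parity separates the two halves of the walk. Inside a half the zigzag is injective modulo
    -- `m`, where the sign `σ` is removed by multiplying with it once more.
    long-injective : ∀ l i j → i < m → j < m → long l i ≅ long l j [ m ] → i ≡ j
    long-injective l i j i<m j<m p with lowHigh i i<m | lowHigh j j<m
    ... | low i<h | low j<h = zig-injective h (upperRow l) i j i<h j<h
        (subst₂ (_≅_[ m ]) (long-low l i i<h) (long-low l j j<h) p)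
    ... | high {i′} i<h | high {j′} j<h = cong (h ℕ.+_) (zig-injective h (toℕ l) i′ j′ i<h j<h
        (subst₂ (_≅_[ m ]) (σσ _) (σσ _) (*-≅ σ (+-cancelˡ-≅ (c l)
            (subst₂ (_≅_[ m ]) (long-high l i′) (long-high l j′) p)))))
      where
      σσ : ∀ x → σ * (σ * x) ≡ x
      σσ x = trans (sym (ℤₚ.*-assoc σ σ x)) (trans (cong (_* x) σ²≡1) (ℤₚ.*-identityˡ x))
    ... | low i<h | high {j′} _ = ⊥-elim (0≇1 (≅-trans (≅-sym (low≅0 l i i<h))
        (≅-trans (≅-weaken 2∣m p) (high≅1 l j′))))
    ... | high {i′} _ | low j<h = ⊥-elim (0≇1 (≅-trans (≅-sym (low≅0 l j j<h))
        (≅-trans (≅-weaken 2∣m (≅-sym p)) (high≅1 l i′))))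

    w₀-injective : ∀ β i j → i < r β → j < r β → w₀ β i ≅ w₀ β j [ r β ] → i ≡ j
    w₀-injective (inj₁ e)        = zig-injective-half h (short⇒h-odd e) (a ℕ.+ toℕ e)
    w₀-injective (inj₂ (inj₁ l)) = long-injective l
    w₀-injective (inj₂ (inj₂ k)) zero zero _ _ p = refl
    w₀-injective (inj₂ (inj₂ k)) zero (suc zero) _ _ p = ⊥-elim (0≇1 (≅-trans p (g-odd k)))
    w₀-injective (inj₂ (inj₂ k)) (suc zero) zero _ _ p = ⊥-elim (0≇1 (≅-trans (≅-sym p) (g-odd k)))
    w₀-injective (inj₂ (inj₂ k)) (suc zero) (suc zero) _ _ p = refl
    w₀-injective (inj₂ (inj₂ k)) (suc (suc i)) j (s≤s (s≤s ())) _ p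
    w₀-injective (inj₂ (inj₂ k)) zero (suc (suc j)) _ (s≤s (s≤s ())) p
    w₀-injective (inj₂ (inj₂ k)) (suc zero) (suc (suc j)) _ (s≤s (s≤s ())) p

    Σ-⊎ : ((Fin ε × Fin h) ⊎ ((Fin a × Fin m) ⊎ (Fin t × Fin 2))) ↔ Σ Base (Fin ∘ r)
    Σ-⊎ = mk↔ₛ′
      (λ { (inj₁ (e , s)) → inj₁ e , s ; (inj₂ (inj₁ (l , s))) → inj₂ (inj₁ l) , s ; (inj₂ (inj₂ (k , s)))
          → inj₂ (inj₂ k) , s })
      (λ { (inj₁ e , s) → inj₁ (e , s) ; (inj₂ (inj₁ l) , s) → inj₂ (inj₁ (l , s)) ; (inj₂ (inj₂ k) , s) →
          inj₂ (inj₂ (k , s)) })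
      (λ { (inj₁ _ , _) → refl ; (inj₂ (inj₁ _) , _) → refl ; (inj₂ (inj₂ _) , _) → refl })
      (λ { (inj₁ _) → refl ; (inj₂ (inj₁ _)) → refl ; (inj₂ (inj₂ _)) → refl })

    positions : Fin (b ℕ.* m′) ↔ Σ Base (Fin ∘ r)
    positions = subst (λ k → Fin k ↔ Σ Base (Fin ∘ r)) count
      (Σ-⊎ ↔-∘ ((Finₚ.*↔× ⊎-↔ ((Finₚ.*↔× ⊎-↔ Finₚ.*↔×) ↔-∘ Finₚ.+↔⊎)) ↔-∘ Finₚ.+↔⊎))

    open FromWalks.System m′ b 3≤N Base r r≢0 r∣m w₀ w₀-injective
      (Inverse.to positions) (Inverse.from positions) (Inverse.strictlyInverseˡ positions)
          (Inverse.strictlyInverseʳ positions)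
      public
    private
      N : ℕ
      N = m ℕ.* (b ℕ.+ b)

    open Classes m′ b N (FromWalks.N≡ m′ b) public

    private
      module E (β : Base) = Extend (r β) {{r≢0 β}} (w₀ β)

    step-at : ∀ β i → i < r β → Position
    step-at β i p = β , fromℕ< p

    stepAt-inner : ∀ β i (p : i < r β) → suc i < r β → stepAt (step-at β i p) ≡ w₀ β (suc i) - w₀ β i
    stepAt-inner β i p q = trans (cong (λ k → w β (suc k) - w β k) (Finₚ.toℕ-fromℕ< p)) (E.step-inner β q)

    stepAt-last : ∀ β i (p : i < r β) → suc i ≡ r β → stepAt (step-at β i p) ≡ w₀ β 0 + + r β - w₀ β i
    stepAt-last β i p q = trans (cong (λ k → w β (suc k) - w β k) (Finₚ.toℕ-fromℕ< p)) (E.step-last β q)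

    record Hit (d : ℤ) : Set where
      constructor _,_
      field
        position : Position
        hits     : stepAt position ≡ d ⊎ stepAt position ≡ - d

    Hit-sign : ∀ {d} → Hit (- d) → Hit d
    Hit-sign (z , inj₁ e) = z , inj₂ e
    Hit-sign {d} (z , inj₂ e) = z , inj₁ (trans e (ℤₚ.neg-involutive d))

    -- As h is odd, the zigzag ends at its even index h - 1 with the value h - 1, one below the
    -- value h that opens the next period.
    short-hit : (e : Fin ε) → Hit (+ 1)
    short-hit e = step-at (inj₁ e) h′ ℕₚ.≤-refl , inj₁ (trans (stepAt-last (inj₁ e) h′ ℕₚ.≤-refl refl)
      (trans (cong (λ x → + 0 + + h - x) (zig-even m (a ℕ.+ toℕ e) h′ h′-even)) (lem (+ h′))))
      where
      h′-even : even h′ ≡ true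
      h′-even = trans (sym (not-involutive (even h′))) (cong not (short⇒h-odd e))
      lem : ∀ x → + 0 + (+ 1 + x) - x ≡ + 1
      lem = solve-∀

    middle-hit : ∀ l → Hit (c l - zig m (upperRow l) h′)
    middle-hit l = step-at β h′ h′<m , inj₁ (trans (stepAt-inner β h′ h′<m h<m)
        (cong₂ _-_ top (long-low l h′ ℕₚ.≤-refl)))
      where
      β = inj₂ (inj₁ l)
      h<m : h < m
      h<m = ℕₚ.m<m+n h (s≤s z≤n)
      h′<m : h′ < m
      h′<m = ℕₚ.<-trans (ℕₚ.n<1+n h′) h<m
      lem : ∀ c s → c + s * + 0 ≡ c
      lem = solve-∀
      top : long l h ≡ c l
      top = trans (cong (long l) (sym (ℕₚ.+-identityʳ h))) (trans (long-high l 0) (lem (c l) σ))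

    last-hit : ∀ l → Hit (+ m - (c l + σ * zig m (toℕ l) h′))
    last-hit l = step-at β (h ℕ.+ h′) p , inj₁ (trans (stepAt-last β (h ℕ.+ h′) p e)
        (cong₂ (λ x y → x + + m - y) (long-low l 0 (s≤s z≤n)) (long-high l h′)))
      where
      β = inj₂ (inj₁ l)
      e : suc (h ℕ.+ h′) ≡ m
      e = sym (ℕₚ.+-suc h h′)
      p : h ℕ.+ h′ < m
      p = ℕₚ.≤-reflexive e

    pair-hit : ∀ k → Hit (g k)
    pair-hit k = step-at (inj₂ (inj₂ k)) 0 (s≤s z≤n) , inj₁
        (trans (stepAt-inner (inj₂ (inj₂ k)) 0 (s≤s z≤n) (s≤s (s≤s z≤n))) (ℤₚ.+-identityʳ (g k)))

    pair-hit⁻ : ∀ k → Hit (g k - + 2)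
    pair-hit⁻ k = step-at (inj₂ (inj₂ k)) 1 (s≤s (s≤s z≤n)) , inj₂
        (trans (stepAt-last (inj₂ (inj₂ k)) 1 (s≤s (s≤s z≤n)) refl) (lem (g k)))
      where
      lem : ∀ g → + 0 + + 2 - g ≡ - (g - + 2)
      lem = solve-∀

    ±σ : ∀ {x d} → x ≡ d ⊎ x ≡ - d → σ * x ≡ d ⊎ σ * x ≡ - d
    ±σ {x} {d} = go σ≡±1
      where
      go : σ ≡ + 1 ⊎ σ ≡ - (+ 1) → x ≡ d ⊎ x ≡ - d → σ * x ≡ d ⊎ σ * x ≡ - d
      go (inj₁ e) p = Sum.map (trans σx≡x) (trans σx≡x) p
        where
        σx≡x : σ * x ≡ x
        σx≡x = trans (cong (_* x) e) (ℤₚ.*-identityˡ x)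
      go (inj₂ e) p = swap (Sum.map (λ q → trans σx≡-x (cong -_ q))
          (λ q → trans σx≡-x (trans (cong -_ q) (ℤₚ.neg-involutive d))) p)
        where
        σx≡-x : σ * x ≡ - x
        σx≡-x = trans (cong (_* x) e) (ℤₚ.-1*i≡-i x)

    ≡-± : ∀ {x y d} → x ≡ y → y ≡ d ⊎ y ≡ - d → x ≡ d ⊎ x ≡ - d
    ≡-± refl p = p

    row-hit : (q : Fin b) → ∀ i → i < h′ → Hit (+ toℕ q * + m + + suc (suc (i ℕ.+ i)))
    row-hit q i i<h′ with splitAt a q in eq
    ... | inj₁ l = step-at β (h ℕ.+ i) p , ≡-±
        (trans (stepAt-inner β (h ℕ.+ i) p p′)
          (trans (cong₂ _-_ (trans (cong (long l) (sym (ℕₚ.+-suc h i))) (long-high l (suc i)))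
              (long-high l i)) (lem (c l) σ _ _)))
        (±σ (subst (λ q → zig m (toℕ l) (suc i) - zig m (toℕ l) i ≡ d q ⊎ zig m (toℕ l) (suc i) - zig m
            (toℕ l) i ≡ - d q) l≡ (zig-step m (toℕ l) i)))
      where
      β = inj₂ (inj₁ l)
      d : ℕ → ℤ
      d q = + q * + m + + suc (suc (i ℕ.+ i))
      l≡ : toℕ l ≡ toℕ q
      l≡ = trans (sym (Finₚ.toℕ-↑ˡ l (ε ℕ.+ a))) (cong toℕ (Finₚ.splitAt⁻¹-↑ˡ eq))
      p′ : suc (h ℕ.+ i) < m
      p′ = subst (_< m) (ℕₚ.+-suc h i) (ℕₚ.+-monoʳ-< h (s≤s i<h′))
      p : h ℕ.+ i < m
      p = ℕₚ.<-trans (ℕₚ.n<1+n _) p′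
      lem : ∀ c s x y → (c + s * x) - (c + s * y) ≡ s * (x - y)
      lem = solve-∀
    ... | inj₂ q₁ with splitAt ε q₁ in eq₁
    ... | inj₁ e = step-at (inj₁ e) i p , ≡-± (stepAt-inner (inj₁ e) i p (s≤s i<h′))
        (subst (λ q → zig m (a ℕ.+ toℕ e) (suc i) - zig m (a ℕ.+ toℕ e) i ≡ d q ⊎ zig m (a ℕ.+ toℕ e)
            (suc i) - zig m (a ℕ.+ toℕ e) i ≡ - d q) e≡ (zig-step m (a ℕ.+ toℕ e) i))
      where
      d : ℕ → ℤ
      d q = + q * + m + + suc (suc (i ℕ.+ i))
      p : i < h
      p = ℕₚ.<-trans i<h′ (ℕₚ.n<1+n h′)
      e≡ : a ℕ.+ toℕ e ≡ toℕ q
      e≡ = trans (cong (a ℕ.+_) (trans (sym (Finₚ.toℕ-↑ˡ e a)) (cong toℕ (Finₚ.splitAt⁻¹-↑ˡ eq₁))))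
             (trans (sym (Finₚ.toℕ-↑ʳ a q₁)) (cong toℕ (Finₚ.splitAt⁻¹-↑ʳ eq)))
    ... | inj₂ u = step-at β i p , ≡-± (trans (stepAt-inner β i p p′)
        (cong₂ _-_ (long-low l (suc i) (s≤s i<h′)) (long-low l i i<h)))
        (subst (λ q → zig m (upperRow l) (suc i) - zig m (upperRow l) i ≡ d q ⊎ zig m (upperRow l)
            (suc i) - zig m (upperRow l) i ≡ - d q) u≡ (zig-step m (upperRow l) i))
      where
      l = opposite u
      β = inj₂ (inj₁ l)
      d : ℕ → ℤ
      d q = + q * + m + + suc (suc (i ℕ.+ i))
      i<h : i < h
      i<h = ℕₚ.<-trans i<h′ (ℕₚ.n<1+n h′)
      p′ : suc i < m
      p′ = ℕₚ.<-≤-trans (s≤s i<h′) (ℕₚ.m≤m+n h h)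
      p : i < m
      p = ℕₚ.<-trans (ℕₚ.n<1+n i) p′
      u≡ : upperRow l ≡ toℕ q
      u≡ = trans (cong (λ x → a ℕ.+ (ε ℕ.+ toℕ x)) (Finₚ.opposite-involutive u))
             (trans (cong (a ℕ.+_) (trans (sym (Finₚ.toℕ-↑ʳ ε u)) (cong toℕ (Finₚ.splitAt⁻¹-↑ʳ eq₁))))
               (trans (sym (Finₚ.toℕ-↑ʳ a q₁)) (cong toℕ (Finₚ.splitAt⁻¹-↑ʳ eq))))

    module _ (odd-hit : ∀ l → l < h ℕ.* b → Hit (+ suc (l ℕ.+ l))) where

      -- As `m` is even, the parity of a representative is that of its residue ρ + 1. Even ones are
      -- treated row by row; the odd ones are just the odd numbers below N/2, and their rows are
      -- forgotten.
      rep-hit : ∀ q ρ → Hit (rep q ρ)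
      rep-hit q ρ = subst (Hit ∘ +_) (sym (repℕ≡ q ρ)) (go (toℕ ρ) (Finₚ.toℕ<n ρ))
        where
        odd-eq : ∀ h q k → suc ((h ℕ.* q ℕ.+ k) ℕ.+ (h ℕ.* q ℕ.+ k)) ≡ (h ℕ.+ h) ℕ.* q ℕ.+ suc (k ℕ.+ k)
        odd-eq = ℕS.solve-∀
        even-eq : ∀ q k → + q * + m + + suc (suc (k ℕ.+ k)) ≡ + (m ℕ.* q ℕ.+ suc (suc (k ℕ.+ k)))
        even-eq q k = cong (λ x → x + + suc (suc (k ℕ.+ k)))
            (trans (sym (ℤₚ.pos-* q m)) (cong +_ (ℕₚ.*-comm q m)))
        go : ∀ ρ → ρ < m′ → Hit (+ (m ℕ.* toℕ q ℕ.+ suc ρ))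
        go ρ ρ<m′ with halves ρ
        ... | double k   = subst (Hit ∘ +_) (odd-eq h (toℕ q) k) (odd-hit (h ℕ.* toℕ q ℕ.+ k)
                (ℕₚ.<-≤-trans (ℕₚ.+-monoʳ-< (h ℕ.* toℕ q) (halve-< (ℕₚ.<-trans ρ<m′ (ℕₚ.n<1+n m′))))
                  (ℕₚ.≤-trans (ℕₚ.≤-reflexive (trans (ℕₚ.+-comm _ h) (sym (ℕₚ.*-suc h (toℕ q)))))
                      (ℕₚ.*-monoʳ-≤ h (Finₚ.toℕ<n q)))))
        ... | double+1 k = subst Hit (even-eq (toℕ q) k)
            (row-hit q k (halve-< (ℕₚ.≤-pred (subst (suc (k ℕ.+ k) <_) (ℕₚ.+-suc h′ h′) ρ<m′))))

      construction : CyclicSymHCSExists m (b ℕ.+ b)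
      construction = system {{ℕ.>-nonZero (ℕₚ.≤-trans (s≤s z≤n) 3≤N)}}
          (λ q ρ → Hit.position (rep-hit q ρ)) (λ q ρ → Sum.map ≅-reflexive ≅-reflexive
          (Hit.hits (rep-hit q ρ)))

-- The odd classes

module OddHalf (p a ε : ℕ) (ε≤1 : ε ≤ 1) (0<b : 0 < a ℕ.+ (ε ℕ.+ a)) where

  private
    h′ h m b t : ℕ
    h′ = p ℕ.+ p
    h = suc h′
    m = h ℕ.+ h
    b = a ℕ.+ (ε ℕ.+ a)
    t = p ℕ.* b

    -- The pairs of odd classes with the larger member `G j` are {1, 3}, {5, 7}, ... for ε = 0. For
    -- ε = 1 the class 1 is the closing step of the short walk, and the pairs are {3, 5}, {7, 9},
    -- ....
    G : ℕ → ℕ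
    G j = 3 ℕ.+ (ε ℕ.+ ε) ℕ.+ 4 ℕ.* j

    abstract
      G-odd : ∀ j → even (G j) ≡ false
      G-odd j = trans (cong even (lem ε j)) (cong not (even-double (1 ℕ.+ ε ℕ.+ 2 ℕ.* j)))
        where
        lem : ∀ e j → 3 ℕ.+ (e ℕ.+ e) ℕ.+ 4 ℕ.* j ≡ suc ((1 ℕ.+ e ℕ.+ 2 ℕ.* j) ℕ.+ (1 ℕ.+ e ℕ.+ 2 ℕ.* j))
        lem = ℕS.solve-∀

      count : ε ℕ.* h ℕ.+ (a ℕ.* m ℕ.+ t ℕ.* 2) ≡ b ℕ.* (h′ ℕ.+ h)
      count = lem ε p a
        where
        lem : ∀ e p a → e ℕ.* suc (p ℕ.+ p) ℕ.+ (a ℕ.* (suc (p ℕ.+ p) ℕ.+ suc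
            (p ℕ.+ p)) ℕ.+ p ℕ.* (a ℕ.+ (e ℕ.+ a)) ℕ.* 2)
          ≡ (a ℕ.+ (e ℕ.+ a)) ℕ.* ((p ℕ.+ p) ℕ.+ suc (p ℕ.+ p))
        lem = ℕS.solve-∀

      3≤N : 3 ≤ m ℕ.* (b ℕ.+ b)
      3≤N = ℕₚ.≤-trans (ℕₚ.n≤1+n 3) (ℕₚ.*-mono-≤ {2} {m} {2} (ℕₚ.+-mono-≤ (s≤s z≤n) (s≤s z≤n))
          (ℕₚ.+-mono-≤ 0<b 0<b))

      c-odd : ∀ j → + (G j ℕ.+ h′) ≅ + 1 [ 2 ]
      c-odd j = +-≅ (odd⇒≅1 (G j) (G-odd j)) (even⇒≅0 h′ (even-double p))

  -- The choice c = G + h − 1 makes the two odd steps of a long walk equal to G and 2 − G.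
  open Construction.Walks h′ a ε t (λ _ → cong not (even-double p)) (λ l → + (G (toℕ l) ℕ.+ h′))
      (λ l → c-odd (toℕ l))
    (+ 1) (inj₁ refl) (λ k → + G (a ℕ.+ toℕ k)) (λ k → odd⇒≅1 (G (a ℕ.+ toℕ k)) (G-odd (a ℕ.+ toℕ k))) 3≤N
        count

  private
    -- Long walks and walks of period 2 use pairs of the same form, so the pairs are handed out in
    -- order, the first `a` of them to the long walks.
    adjacent-hits : ∀ j → j < a ℕ.+ t → Hit (+ G j) × Hit (+ G j - + 2)
    adjacent-hits j j<a+t with j ℕ.<? a
    ... | yes j<a = subst (λ j → Hit (+ G j) × Hit (+ G j - + 2)) (Finₚ.toℕ-fromℕ< j<a) (at (fromℕ< j<a))
      where
      lem₁ : ∀ g x → g + x - x ≡ g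
      lem₁ = solve-∀
      lem₂ : ∀ g x → (+ 1 + x) + (+ 1 + x) - ((g + x) + + 1 * x) ≡ - (g - + 2)
      lem₂ = solve-∀
      at : ∀ l → Hit (+ G (toℕ l)) × Hit (+ G (toℕ l) - + 2)
      at l = subst Hit (trans (cong (λ x → + (G (toℕ l) ℕ.+ h′) - x)
          (zig-even m (upperRow l) h′ (even-double p))) (lem₁ (+ G (toℕ l)) (+ h′))) (middle-hit l)
           , Hit-sign (subst Hit (trans (cong (λ x → + m - (+ (G (toℕ l) ℕ.+ h′) + + 1 * x))
               (zig-even m (toℕ l) h′ (even-double p))) (lem₂ (+ G (toℕ l)) (+ h′))) (last-hit l))
    ... | no j≮a = subst (λ j → Hit (+ G j) × Hit (+ G j - + 2)) j≡ (pair-hit k , pair-hit⁻ k)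
      where
      e : a ℕ.+ (j ℕ.∸ a) ≡ j
      e = ℕₚ.m+[n∸m]≡n (ℕₚ.≮⇒≥ j≮a)
      k<t : j ℕ.∸ a < t
      k<t = ℕₚ.+-cancelˡ-< a _ _ (subst (_< a ℕ.+ t) (sym e) j<a+t)
      k = fromℕ< k<t
      j≡ : a ℕ.+ toℕ k ≡ j
      j≡ = trans (cong (a ℕ.+_) (Finₚ.toℕ-fromℕ< k<t)) e

    odd-hit : ∀ l → l < h ℕ.* b → Hit (+ suc (l ℕ.+ l))
    odd-hit l l<hb with l ℕ.<? ε
    ... | yes l<ε = subst (λ l → Hit (+ suc (l ℕ.+ l))) (sym (ℕₚ.n<1⇒n≡0 (ℕₚ.<-≤-trans l<ε ε≤1)))
        (short-hit (fromℕ< l<ε))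
    ... | no l≮ε with l ℕ.∸ ε | ℕₚ.m+[n∸m]≡n (ℕₚ.≮⇒≥ l≮ε)
    ... | l′ | refl = go l′ (halves l′) (ℕₚ.+-cancelˡ-< ε _ _ (subst (ε ℕ.+ l′ <_) (lem ε p a) l<hb))
      where
      lem : ∀ e p a → suc (p ℕ.+ p) ℕ.* (a ℕ.+ (e ℕ.+ a)) ≡ e ℕ.+
          ((a ℕ.+ p ℕ.* (a ℕ.+ (e ℕ.+ a))) ℕ.+ (a ℕ.+ p ℕ.* (a ℕ.+ (e ℕ.+ a))))
      lem = ℕS.solve-∀
      lem₁ : ∀ e j → (+ 3 + (e + e) + (j + (j + (j + (j + + 0))))) - + 2 ≡ + 1
          + ((e + (j + j)) + (e + (j + j)))
      lem₁ = solve-∀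
      lem₂ : ∀ e j → 3 ℕ.+ (e ℕ.+ e) ℕ.+ 4 ℕ.* j ≡ suc ((e ℕ.+ suc (j ℕ.+ j)) ℕ.+ (e ℕ.+ suc (j ℕ.+ j)))
      lem₂ = ℕS.solve-∀
      -- For l = ε + l′ the number 2l + 1 is G j - 2 if l′ = 2j, and G j if l′ = 2j + 1.
      go : ∀ l′ → Halves l′ → l′ < (a ℕ.+ t) ℕ.+ (a ℕ.+ t) → Hit (+ suc ((ε ℕ.+ l′) ℕ.+ (ε ℕ.+ l′)))
      go _ (double j) p = subst Hit (lem₁ (+ ε) (+ j)) (proj₂ (adjacent-hits j (halve-< p)))
      go _ (double+1 j) p = subst (Hit ∘ +_) (lem₂ ε j)
          (proj₁ (adjacent-hits j (halve-< (ℕₚ.<-trans (ℕₚ.n<1+n _) p))))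

  exists : CyclicSymHCSExists m (b ℕ.+ b)
  exists = construction odd-hit

-- The odd classes when m/2 is even

module EvenHalf (p′ a′ : ℕ) where

  private
    p a h′ h m b t : ℕ
    p = suc p′
    a = suc a′
    h′ = p′ ℕ.+ suc p′
    h = suc h′
    m = h ℕ.+ h
    b = a ℕ.+ a
    t = (a ℕ.+ a) ℕ.* p′ ℕ.+ a

    even-h : even h ≡ true
    even-h = even-double p

    even-h′ : even h′ ≡ false
    even-h′ = trans (sym (not-involutive (even h′))) (cong not even-h)

    m≅0 : + m ≅ + 0 [ 2 ]
    m≅0 = even⇒≅0 m (even-double h)

    -- The long walk l is to have the last step G l, which forces its middle step 2(a − l)m − G l. For
    -- l > 0 these are (a − l)m ∓ 1, so what remains can be paired as {4i − 1, 4i + 1}, apart from the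
    -- classes 1 and N/2 − 1, which go to l = 0.
    G : Fin a → ℤ
    G Fin.zero    = + 1
    G (Fin.suc x) = + suc (toℕ (opposite x)) * + m - + 1

    -- Solution of m - (c - z) = G l, where z = -(lm + h) is the end of the zigzag in row l and the
    -- sign `σ` is -1.
    c : Fin a → ℤ
    c l = + h - + toℕ l * + m - G l

    abstract
      G-odd : ∀ l → G l ≅ + 1 [ 2 ]
      G-odd Fin.zero = ≅-refl
      G-odd (Fin.suc x) = ≅-trans (minus-≅ (*-≅ (+ suc (toℕ (opposite x))) m≅0) ≅-refl)
          (by (- (+ 1)) (lem (+ suc (toℕ (opposite x)))))
        where
        lem : ∀ x → x * + 0 - + 1 ≡ + 1 + - (+ 1) * + 2
        lem = solve-∀

      c-odd : ∀ l → c l ≅ + 1 [ 2 ]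
      c-odd l = ≅-trans (minus-≅ (minus-≅ (even⇒≅0 h even-h) (*-≅ (+ toℕ l) m≅0)) (G-odd l))
          (by (- (+ 1)) (lem (+ toℕ l)))
        where
        lem : ∀ x → + 0 - x * + 0 - + 1 ≡ + 1 + - (+ 1) * + 2
        lem = solve-∀

    -- The numbers i whose pair {4i - 1, 4i + 1} falls to a walk of period 2: those not divisible by
    -- p, then the multiples kp with a ≤ k < 2a. Since 4p = m, the remaining multiples kp, 0 < k <
    -- a, have the pairs km ∓ 1 used by long walks.
    center′ : Fin ((a ℕ.+ a) ℕ.* p′) ⊎ Fin a → ℕ
    center′ (inj₁ y) = toℕ (proj₁ (remQuot {a ℕ.+ a} p′ y)) ℕ.* p ℕ.+ suc
        (toℕ (proj₂ (remQuot {a ℕ.+ a} p′ y)))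
    center′ (inj₂ k) = (a ℕ.+ toℕ k) ℕ.* p

    center : Fin t → ℕ
    center = center′ ∘ splitAt ((a ℕ.+ a) ℕ.* p′)

    abstract
      g-odd : ∀ k → + suc (4 ℕ.* center k) ≅ + 1 [ 2 ]
      g-odd k = odd⇒≅1 (suc (4 ℕ.* center k)) (cong not
          (trans (cong even (lem (center k))) (even-double (2 ℕ.* center k))))
        where
        lem : ∀ x → 4 ℕ.* x ≡ 2 ℕ.* x ℕ.+ 2 ℕ.* x
        lem = ℕS.solve-∀

      count : 0 ℕ.* h ℕ.+ (a ℕ.* m ℕ.+ t ℕ.* 2) ≡ b ℕ.* (h′ ℕ.+ h)
      count = lem p′ a
        where
        lem : ∀ p a → a ℕ.* (suc (p ℕ.+ suc p) ℕ.+ suc (p ℕ.+ suc p)) ℕ.+ ((a ℕ.+ a) ℕ.* p ℕ.+ a) ℕ.* 2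
          ≡ (a ℕ.+ a) ℕ.* ((p ℕ.+ suc p) ℕ.+ suc (p ℕ.+ suc p))
        lem = ℕS.solve-∀

      3≤N : 3 ≤ m ℕ.* (b ℕ.+ b)
      3≤N = ℕₚ.≤-trans (ℕₚ.n≤1+n 3) (ℕₚ.*-mono-≤ {2} {m} {2} (ℕₚ.+-mono-≤ (s≤s z≤n) (s≤s z≤n))
          (ℕₚ.+-mono-≤ {1} {b} {1} (s≤s z≤n) (s≤s z≤n)))

  open Construction.Walks h′ a 0 t (λ ()) c c-odd (- (+ 1)) (inj₂ refl) (λ k → + suc (4 ℕ.* center k))
      g-odd 3≤N count

  private
    last-G : ∀ l → Hit (G l)
    last-G l = subst Hit (trans (cong (λ z → + m - (c l + - (+ 1) * z)) (zig-odd m (toℕ l) h′ even-h′))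
        (lem (+ h) (+ toℕ l * (+ m)) (G l))) (last-hit l)
      where
      lem : ∀ h x g → h + h - ((h - x - g) + - (+ 1) * - (x + h)) ≡ g
      lem = solve-∀

    middle-G : ∀ l → Hit (+ 2 * + suc (toℕ (opposite l)) * + m - G l)
    middle-G l = subst Hit (trans (cong (λ z → c l - z)
        (trans (zig-odd m (upperRow l) h′ even-h′) (cong (λ z → - (+ z * + m + + h)) U≡)))
      (lem (+ h) (+ toℕ l) (+ o) (G l))) (middle-hit l)
      where
      o = toℕ (opposite l)
      U≡ : upperRow l ≡ suc (o ℕ.+ toℕ l) ℕ.+ o
      U≡ = cong (ℕ._+ o) (trans (sym (ℕₚ.m∸n+n≡m (Finₚ.toℕ<n l)))
          (trans (cong (ℕ._+ suc (toℕ l)) (sym (Finₚ.opposite-prop l))) (ℕₚ.+-suc o (toℕ l))))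
      lem : ∀ h l o g → (h - l * (h + h) - g) - - ((+ 1 + (o + l) + o) * (h + h) + h) ≡ + 2 * (+
          1 + o) * (h + h) - g
      lem = solve-∀

    record Around (i : ℕ) : Set where
      constructor _,_
      field
        above : Hit (+ suc (4 ℕ.* i))
        below : Hit (+ (4 ℕ.* i) - + 1)

    open Around

    lem-1 : ∀ x → (+ 1 + x) - + 2 ≡ x - + 1
    lem-1 = solve-∀

    pair-around : ∀ k → Around (center k)
    pair-around k = pair-hit k , subst Hit (lem-1 (+ (4 ℕ.* center k))) (pair-hit⁻ k)

    4p≡m : ∀ k → 4 ℕ.* (k ℕ.* p) ≡ k ℕ.* m
    4p≡m k = lem k p′
      where
      lem : ∀ k p → 4 ℕ.* (k ℕ.* suc p) ≡ k ℕ.* (suc (p ℕ.+ suc p) ℕ.+ suc (p ℕ.+ suc p))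
      lem = ℕS.solve-∀

    long-around : ∀ y → y < a′ → Around (suc y ℕ.* p)
    long-around y y<a′ = subst Hit (trans (cong₂ (λ o o′ → + 2 * + suc o * + m - (+ suc o′ * + m - + 1))
        o₁ o₂) (trans (lem (+ suc y * + m)  (+ suc y) (+ m) refl) (cong (λ z → + 1 + z) km≡))) (middle-G l)
      , subst Hit (trans (cong (λ o → + suc o * + m - + 1) o₂) (cong (λ z → z - + 1) km≡)) (last-G l)
      where
      x = opposite (fromℕ< y<a′)
      l = Fin.suc x
      o₂ : toℕ (opposite x) ≡ y
      o₂ = trans (cong toℕ (Finₚ.opposite-involutive (fromℕ< y<a′))) (Finₚ.toℕ-fromℕ< y<a′)
      o₁ : toℕ (opposite l) ≡ y
      o₁ = trans (Finₚ.opposite-suc x) o₂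
      lem : ∀ z k m → z ≡ k * m → + 2 * k * m - (k * m - + 1) ≡ + 1 + z
      lem _ k m refl = lem′ k m
        where
        lem′ : ∀ k m → + 2 * k * m - (k * m - + 1) ≡ + 1 + k * m
        lem′ = solve-∀
      km≡ : + suc y * + m ≡ + (4 ℕ.* (suc y ℕ.* p))
      km≡ = trans (sym (ℤₚ.pos-* (suc y) m)) (cong +_ (sym (4p≡m (suc y))))

    low-around : ∀ k o → k < a ℕ.+ a → o < p′ → Around (k ℕ.* p ℕ.+ suc o)
    low-around k o k< o< = subst Around
      (trans (cong center′ (Finₚ.splitAt-↑ˡ _ (combine k̂ ô) a))
        (trans (cong (λ z → toℕ (proj₁ z) ℕ.* p ℕ.+ suc (toℕ (proj₂ z))) (Finₚ.remQuot-combine k̂ ô))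
          (cong₂ (λ x y → x ℕ.* p ℕ.+ suc y) (Finₚ.toℕ-fromℕ< k<) (Finₚ.toℕ-fromℕ< o<))))
      (pair-around (combine k̂ ô Fin.↑ˡ a))
      where
      k̂ = fromℕ< k<
      ô = fromℕ< o<

    high-around : ∀ k → k < a → Around ((a ℕ.+ k) ℕ.* p)
    high-around k k< = subst Around
      (trans (cong center′ (Finₚ.splitAt-↑ʳ ((a ℕ.+ a) ℕ.* p′) a k̂))
          (cong (λ x → (a ℕ.+ x) ℕ.* p) (Finₚ.toℕ-fromℕ< k<)))
      (pair-around (((a ℕ.+ a) ℕ.* p′) Fin.↑ʳ k̂))
      where
      k̂ = fromℕ< k<

    around : ∀ k o → 0 < k ℕ.* p ℕ.+ o → k < a ℕ.+ a → o < p → Around (k ℕ.* p ℕ.+ o)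
    around k (suc o) _ k< (s≤s o<) = low-around k o k< o<
    around k zero 0< k< _ = subst Around (sym (ℕₚ.+-identityʳ (k ℕ.* p)))
        (go k (subst (0 <_) (ℕₚ.+-identityʳ (k ℕ.* p)) 0<) k<)
      where
      go : ∀ k → 0 < k ℕ.* p → k < a ℕ.+ a → Around (k ℕ.* p)
      go (suc y) _ k< with suc y ℕ.<? a
      ... | yes (s≤s y<a′) = long-around y y<a′
      ... | no k≮a = subst (λ k → Around (k ℕ.* p)) e
          (high-around (suc y ℕ.∸ a) (ℕₚ.+-cancelˡ-< a _ _ (subst (_< a ℕ.+ a) (sym e) k<)))
        where
        e : a ℕ.+ (suc y ℕ.∸ a) ≡ suc y
        e = ℕₚ.m+[n∸m]≡n (ℕₚ.≮⇒≥ k≮a)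

    around′ : ∀ i → 0 < i → i < (a ℕ.+ a) ℕ.* p → Around i
    around′ i 0<i i< = subst Around (sym i≡) (around (i / p) (i % p) (subst (0 <_) i≡ 0<i)
        (ℕᵈ.m<n*o⇒m/o<n i<) (ℕᵈ.m%n<n i p))
      where
      i≡ : i ≡ i / p ℕ.* p ℕ.+ i % p
      i≡ = trans (ℕᵈ.m≡m%n+[m/n]*n i p) (ℕₚ.+-comm (i % p) _)

    top-hit : Hit (+ (4 ℕ.* ((a ℕ.+ a) ℕ.* p)) - + 1)
    top-hit = subst Hit (trans (cong (λ o → + 2 * + suc o * + m - + 1) (Finₚ.opposite-prop {a} Fin.zero))
      (cong (λ z → z - + 1) (trans (lem (+ a) (+ m))
          (trans (sym (ℤₚ.pos-* (a ℕ.+ a) m)) (cong +_ (sym (4p≡m (a ℕ.+ a)))))))) (middle-G Fin.zero)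
      where
      lem : ∀ a m → + 2 * a * m ≡ (a + a) * m
      lem = solve-∀

    -- The number 2l + 1 is 4i + 1 if l = 2i, and 4i - 1 if l + 1 = 2i. The extreme cases i = 0 of
    -- the former and i = T of the latter are the classes 1 and N/2 - 1, both steps of the long walk
    -- 0.
    odd-hit : ∀ l → l < h ℕ.* b → Hit (+ suc (l ℕ.+ l))
    odd-hit l l<hb = go l (halves (suc l)) refl (subst (l <_) (lem p′ a) l<hb)
      where
      T = (a ℕ.+ a) ℕ.* p
      lem : ∀ p a → suc (p ℕ.+ suc p) ℕ.* (a ℕ.+ a) ≡ (a ℕ.+ a) ℕ.* suc p ℕ.+ (a ℕ.+ a) ℕ.* suc p
      lem = ℕS.solve-∀
      lem₁ : ∀ i → suc (4 ℕ.* i) ≡ suc ((i ℕ.+ i) ℕ.+ (i ℕ.+ i))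
      lem₁ = ℕS.solve-∀
      lem₂ : ∀ i l → + 1 + l ≡ i + i → (i + (i + (i + (i + + 0)))) - + 1 ≡ + 1 + (l + l)
      lem₂ i l e = trans (a₁ i) (trans (cong (λ x → x + x - + 1) (sym e)) (a₂ l))
        where
        a₁ : ∀ i → (i + (i + (i + (i + + 0)))) - + 1 ≡ (i + i) + (i + i) - + 1
        a₁ = solve-∀
        a₂ : ∀ l → (+ 1 + l) + (+ 1 + l) - + 1 ≡ + 1 + (l + l)
        a₂ = solve-∀
      go : ∀ l {sl} → Halves sl → sl ≡ suc l → l < T ℕ.+ T → Hit (+ suc (l ℕ.+ l))
      go l (double+1 zero)    refl l< = last-G Fin.zero
      go l (double+1 (suc i)) refl l< = subst (Hit ∘ +_) (lem₁ (suc i))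
          (above (around′ (suc i) (s≤s z≤n) (halve-< l<)))
      go l (double i)         e    l< with i ℕ.<? T
      ... | yes i<T = subst Hit (lem₂ (+ i) (+ l) (cong +_ (sym e))) (below (around′ i 0<i i<T))
        where
        0<i : 0 < i
        0<i = ℕₚ.n≢0⇒n>0 λ { refl → case e of λ () }
      ... | no i≮T = subst Hit (lem₂ (+ i) (+ l) (cong +_ (sym e)))
          (subst (λ i → Hit (+ (4 ℕ.* i) - + 1)) (sym i≡T) top-hit)
        where
        i≡T : i ≡ T
        i≡T = ℕₚ.≤-antisym (ℕₚ.≮⇒≥ λ T<i → ℕₚ.<⇒≱ (ℕₚ.+-mono-<-≤ T<i (ℕₚ.<⇒≤ T<i))
            (subst (_≤ T ℕ.+ T) (sym e) l<)) (ℕₚ.≮⇒≥ i≮T)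

  exists : CyclicSymHCSExists m (b ℕ.+ b)
  exists = construction odd-hit

-- Symmetries of a hamiltonian cycle

Link-≅ : ∀ {N w x y x′ y′} → x ≅ x′ [ N ] → y ≅ y′ [ N ] → Link N w x y → Link N w x′ y′
Link-≅ p q (inj₁ (step i sx sy)) = inj₁ (step i (≅-trans sx p) (≅-trans sy q))
Link-≅ p q (inj₂ (step i sy sx)) = inj₂ (step i (≅-trans sy q) (≅-trans sx p))

Link-+ : ∀ {N w x y} s → Link N w x y → Link N (λ i → w i + s) (x + s) (y + s)
Link-+ s = Sum.map go go
  where
  go : ∀ {N w x y} → Step N w x y → Step N (λ i → w i + s) (x + s) (y + s)
  go (step i p q) = step i (+-≅ p ≅-refl) (+-≅ q ≅-refl)

SameCycle⇒Link : ∀ {N} .{{_ : NonZero N}} {c c′ w w′} → Lift N c w → Lift N c′ w′ → SameCycle N c c′ →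
    ∀ {x y} → Link N w x y → Link N w′ x y
SameCycle⇒Link {N} L L′ same {x} {y} l = Link-≅ (%ℕ-≅ x) (%ℕ-≅ y)
    (InCycle⇒Link L′ (Equivalence.to (same _ _)
  (Link⇒InCycle L (n%ℕd<d x N) (n%ℕd<d y N) (Link-≅ (≅-sym (%ℕ-≅ x)) (≅-sym (%ℕ-≅ y)) l))))

module Ham (m n : ℕ) .{{m≢0 : NonZero m}} .{{N≢0 : NonZero (m ℕ.* n)}} (C : ℕ → ℕ) (ham : HamCycle m n C) where

  private
    N : ℕ
    N = m ℕ.* n

  open HamCycle ham

  -- Positions on the cycle are integers modulo N.
  opaque
    at : ℤ → ℤ
    at z = + C (z %ℕ N)

    at-% : ∀ z → at z ≡ + C (z %ℕ N)
    at-% z = refl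

  walk : ℕ → ℤ
  walk i = at (+ i)

  C-Lift : Lift N C walk
  range C-Lift = inRange
  lift C-Lift i = ≅-reflexive (at-% (+ i))

  opaque
    unfolding at

    at-cong : ∀ {z z′} → z ≅ z′ [ N ] → at z ≡ at z′
    at-cong {z} {z′} p = cong (+_ ∘ C) (≅⇒≡ (n%ℕd<d z N) (n%ℕd<d z′ N)
        (≅-trans (%ℕ-≅ z) (≅-trans p (≅-sym (%ℕ-≅ z′)))))

    at-injective : ∀ {z z′} → at z ≅ at z′ [ N ] → z ≅ z′ [ N ]
    at-injective {z} {z′} p = ≅-trans (≅-sym (%ℕ-≅ z)) (≅-trans (≅-reflexive (cong +_
      (injective _ _ (n%ℕd<d z N) (n%ℕd<d z′ N) (≅⇒≡ (inRange _ (n%ℕd<d z N)) (inRange _ (n%ℕd<d z′ N))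
          p)))) (%ℕ-≅ z′))

    at-surjective : ∀ x → ∃ λ z → at z ≅ x [ N ]
    at-surjective x = let i , e = injective⇒surjective f f-injective (fromℕ< (n%ℕd<d x N)) in
      + toℕ i , ≅-trans (≅-reflexive (cong +_ (trans (cong C (ℕᵈ.m<n⇒m%n≡m (Finₚ.toℕ<n i)))
        (trans (sym (Finₚ.toℕ-fromℕ< (inRange _ (Finₚ.toℕ<n i))))
            (trans (cong toℕ e) (Finₚ.toℕ-fromℕ< _)))))) (%ℕ-≅ x)
      where
      f : Fin N → Fin N
      f i = fromℕ< (inRange (toℕ i) (Finₚ.toℕ<n i))
      f-injective : ∀ {i j} → f i ≡ f j → i ≡ j
      f-injective {i} {j} e = Finₚ.toℕ-injective (injective _ _ (Finₚ.toℕ<n i) (Finₚ.toℕ<n j)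
        (trans (sym (Finₚ.toℕ-fromℕ< _)) (trans (cong toℕ e) (Finₚ.toℕ-fromℕ< _))))

  at-edge : ∀ z → Step N walk (at z) (at (z + + 1))
  at-edge z = step (z %ℕ N) (≅-reflexive (at-cong (%ℕ-≅ z)))
    (≅-reflexive (at-cong (≅-trans (≅-reflexive (ℤₚ.+-comm (+ 1) (+ (z %ℕ N)))) (+-≅ (%ℕ-≅ z) ≅-refl))))

  opaque
    unfolding at

    at-adjacent : ∀ z → ¬ (at z ≅ at (z + + 1) [ m ])
    at-adjacent z p with suc (z %ℕ N) ℕ.<? N
    ... | yes q = Adj⇒≇ m (adjacent _ q) (≅-trans p
        (≅-reflexive (trans (at-cong z+1≅) (cong (+_ ∘ C) (ℕᵈ.m<n⇒m%n≡m q)))))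
      where
      z+1≅ : z + + 1 ≅ + suc (z %ℕ N) [ N ]
      z+1≅ = ≅-trans (+-≅ (≅-sym (%ℕ-≅ z)) ≅-refl) (≅-reflexive (ℤₚ.+-comm (+ (z %ℕ N)) (+ 1)))
    ... | no ¬q = Adj⇒≇ m closing (≅-trans (≅-reflexive (cong (+_ ∘ C) (sym (cong ℕ.pred e))))
        (≅-trans p (≅-reflexive (trans (at-cong z+1≅) (cong (+_ ∘ C) (ℕᵈ.n%n≡0 N))))))
      where
      e : suc (z %ℕ N) ≡ N
      e = ℕₚ.≤-antisym (n%ℕd<d z N) (ℕₚ.≮⇒≥ ¬q)
      z+1≅ : z + + 1 ≅ + N [ N ]
      z+1≅ = ≅-trans (+-≅ (≅-sym (%ℕ-≅ z)) ≅-refl)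
          (≅-reflexive (trans (ℤₚ.+-comm (+ (z %ℕ N)) (+ 1)) (cong +_ e)))

  2≇0 : ¬ (+ 2 ≅ + 0 [ N ])
  2≇0 p = case ≅⇒≡ length≥3 (ℕₚ.<-≤-trans (s≤s z≤n) length≥3) p of λ ()

  neighbour : ∀ {x y} z → Link N walk x y → x ≅ at z [ N ] → y ≅ at (z + + 1) [ N ] ⊎ y ≅ at (z - + 1) [ N ]
  neighbour z (inj₁ (step i sx sy)) p = inj₁ (≅-trans (≅-sym sy) (≅-reflexive (at-cong
    (≅-trans (+-≅ (≅-refl {x = + 1}) (at-injective (≅-trans sx p))) (≅-reflexive (ℤₚ.+-comm (+ 1) z))))))
  neighbour z (inj₂ (step i sy sx)) p = inj₂ (≅-trans (≅-sym sy) (≅-reflexive (at-cong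
    (≅-via (at-injective (≅-trans sx p)) (lem (+ i) z)))))
    where
    lem : ∀ i z → i - (z - + 1) ≡ (+ 1 + i) - z
    lem = solve-∀

  Invariant : ℤ → Set
  Invariant s = ∀ x y → Link N walk x y → Link N walk (x + s) (y + s)

  neighbour± : ∀ {δ} → δ ≡ + 1 ⊎ δ ≡ - (+ 1) → ∀ {x y} z → Link N walk x y → x ≅ at z [ N ] → y ≅ at
      (z + δ) [ N ] ⊎ y ≅ at (z - δ) [ N ]
  neighbour± (inj₁ refl) z l p = neighbour z l p
  neighbour± (inj₂ refl) z l p = swap (neighbour z l p)

  -- A translation that preserves a cycle is determined by the image of one edge; δ records whether
  -- the direction is kept. In the induction the next vertex goes to one of the two neighbours of
  -- the image just reached, and one of these is already the image of the vertex before; taking it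
  -- would identify positions at distance 2.
  propagate : ∀ {δ} → δ ≡ + 1 ⊎ δ ≡ - (+ 1) → ∀ {s} → Invariant s → ∀ i i′ →
    at i + s ≅ at i′ [ N ] → at (i + + 1) + s ≅ at (i′ + δ) [ N ] → ∀ z → at z + s ≅ at
        (i′ + δ * (z - i)) [ N ]
  -- The induction is over the naturals, so z - i is replaced by its residue modulo `N`.
  propagate {δ} δ≡±1 {s} inv i i′ p₀ p₁ z = subst₂ (λ u v → u + s ≅ v [ N ])
      (at-cong (≅-trans (+-≅ (≅-refl {x = i}) (%ℕ-≅ (z - i))) (≅-reflexive (lem i z))))
      (at-cong (+-≅ (≅-refl {x = i′}) (*-≅ δ (%ℕ-≅ (z - i)))))
      (proj₁ (go ((z - i) %ℕ N)))
    where
    lem : ∀ i z → i + (z - i) ≡ z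
    lem = solve-∀
    P : ℤ → Set
    P l = at (i + l) + s ≅ at (i′ + δ * l) [ N ]
    go : ∀ l → P (+ l) × P (+ suc l)
    go zero = subst₂ (λ u v → at u + s ≅ at v [ N ]) (sym (ℤₚ.+-identityʳ i)) (lem₀ i′ δ) p₀
            , subst (λ v → at (i + + 1) + s ≅ at v [ N ]) (lem₁ i′ δ) p₁
      where
      lem₀ : ∀ i d → i ≡ i + d * + 0
      lem₀ = solve-∀
      lem₁ : ∀ i d → i + d ≡ i + d * + 1
      lem₁ = solve-∀
    go (suc l) with go l
    ... | pₗ , pₗ₊₁ with neighbour± δ≡±1 (i′ + δ * + suc l) (inv _ _ (inj₁ (at-edge (i + + suc l)))) pₗ₊₁
    ... | inj₁ q = pₗ₊₁ , subst₂ (λ u v → at u + s ≅ at v [ N ]) (lem₀ i (+ suc l)) (lem₁ i′ δ (+ suc l)) q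
      where
      lem₀ : ∀ i l → i + l + + 1 ≡ i + (+ 1 + l)
      lem₀ = solve-∀
      lem₁ : ∀ i d l → i + d * l + d ≡ i + d * (+ 1 + l)
      lem₁ = solve-∀
    ... | inj₂ q = ⊥-elim (2≇0 (≅-via (at-injective
        (+-cancelʳ-≅ s (≅-trans q (≅-trans (≅-reflexive (cong at (lem₁ i′ δ (+ l)))) (≅-sym pₗ)))))
        (lem₂ i (+ l))))
      where
      lem₁ : ∀ i d l → i + d * (+ 1 + l) - d ≡ i + d * l
      lem₁ = solve-∀
      lem₂ : ∀ i l → + 2 - + 0 ≡ (i + (+ 1 + l) + + 1) - (i + l)
      lem₂ = solve-∀

  record Periodic (ρ s : ℤ) : Set where
    constructor periodic
    field
      at-+ : ∀ z → at (z + ρ) ≅ at z + s [ N ]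

  open Periodic

  rotation : ∀ {s} → Invariant s → ∀ i i′ → at i + s ≅ at i′ [ N ] → at (i + + 1) + s ≅ at (i′ + + 1) [ N
      ] → Periodic (i′ - i) s
  rotation {s} inv i i′ p q = periodic λ z → ≅-sym
      (≅-trans (propagate (inj₁ refl) inv i i′ p q z) (≅-reflexive (cong at (lem i i′ z))))
    where
    lem : ∀ i i′ z → i′ + + 1 * (z - i) ≡ z + (i′ - i)
    lem = solve-∀

  Periodic-+ : ∀ {ρ s ρ′ s′} → Periodic ρ s → Periodic ρ′ s′ → Periodic (ρ + ρ′) (s + s′)
  at-+ (Periodic-+ {ρ} {s} {ρ′} {s′} p p′) z = ≅-trans (≅-reflexive (cong at (sym (ℤₚ.+-assoc z ρ ρ′))))
    (≅-trans (at-+ p′ (z + ρ)) (≅-trans (+-≅ (at-+ p z) ≅-refl) (≅-reflexive (ℤₚ.+-assoc (at z) s s′))))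

  Periodic-neg : ∀ {ρ s} → Periodic ρ s → Periodic (- ρ) (- s)
  at-+ (Periodic-neg {ρ} {s} p) z = ≅-via⁻ (at-+ p (z - ρ))
      (trans (lem (at (z - ρ)) (at z) s) (cong (λ u → at (z - ρ) + s - at u) (lem₀ z ρ)))
    where
    lem₀ : ∀ z r → z ≡ z - r + r
    lem₀ = solve-∀
    lem : ∀ u v s → u - (v + - s) ≡ u + s - v
    lem = solve-∀

  Periodic-* : ∀ {ρ s} → Periodic ρ s → ∀ k → Periodic (+ k * ρ) (+ k * s)
  at-+ (Periodic-* p zero) z = ≅-reflexive (trans (cong at (ℤₚ.+-identityʳ z))
      (sym (ℤₚ.+-identityʳ (at z))))
  Periodic-* {ρ} {s} p (suc k) = subst₂ Periodic (lem (+ k) ρ) (lem (+ k) s) (Periodic-+ p (Periodic-* p k))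
    where
    lem : ∀ k r → r + k * r ≡ (+ 1 + k) * r
    lem = solve-∀

  diff : ℤ → ℤ
  diff z = at (z + + 1) - at z

  Periodic⇒diff : ∀ {ρ s} → Periodic ρ s → ∀ z → diff (z + ρ) ≅ diff z [ N ]
  Periodic⇒diff {ρ} {s} p z = ≅-via (minus-≅ (≅-trans (≅-reflexive (cong at (lem₀ z ρ)))
      (at-+ p (z + + 1))) (at-+ p z))
     (cong (λ u → diff (z + ρ) - u) (lem (at (z + + 1)) (at z) s))
    where
    lem₀ : ∀ z r → z + r + + 1 ≡ z + + 1 + r
    lem₀ = solve-∀
    lem : ∀ u v s → u - v ≡ u + s - (v + s)
    lem = solve-∀

  -- Since N/2 is a multiple of m, a reflection z ↦ A − z would fix a vertex or an edge of length N/2,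
  -- which joins two vertices of the same part.
  module _ (b : ℕ) (n≡b+b : n ≡ b ℕ.+ b) where

    H : ℕ
    H = b ℕ.* m

    N≡H*2 : N ≡ H ℕ.* 2
    N≡H*2 = trans (cong (m ℕ.*_) n≡b+b) (lem m b)
      where
      lem : ∀ m b → m ℕ.* (b ℕ.+ b) ≡ b ℕ.* m ℕ.* 2
      lem = ℕS.solve-∀

    halve : ∀ {x} → x + x ≅ + 0 [ N ] → x ≅ + 0 [ H ]
    halve {x} (by k e) = by k (ℤₚ.*-cancelʳ-≡ x (+ 0 + k * + H) (+ 2)
        (trans (lem x) (trans e (trans (cong (λ z → + 0 + k * z) (trans (cong +_ N≡H*2) (ℤₚ.pos-* H 2)))
        (lem₂ k (+ H))))))
      where
      lem : ∀ x → x * + 2 ≡ x + x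
      lem = solve-∀
      lem₂ : ∀ k h → + 0 + k * (h * + 2) ≡ (+ 0 + k * h) * + 2
      lem₂ = solve-∀

    no-reflection : ∀ {s} A → ¬ (∀ z → at z + s ≅ at (A - z) [ N ])
    no-reflection {s} A refl-A = go (A %ℕ 2) (n%ℕd<d A 2) (a≡a%ℕn+[a/ℕn]*n A 2)
      where
      k = A /ℕ 2
      -- Reflecting twice is the identity. Hence N/2 divides s, and so does `m`.
      2s≅0 : s + s ≅ + 0 [ N ]
      2s≅0 = ≅-via (+-≅ (refl-A (+ 0)) (refl-A (A - + 0)))
          (trans (lem s (at (+ 0)) (at (A - + 0)))
          (cong (λ u → at (+ 0) + s + (at (A - + 0) + s) - (at (A - + 0) + at u)) (lem₀ A)))
        where
        lem : ∀ s u v → s + s - + 0 ≡ u + s + (v + s) - (v + u)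
        lem = solve-∀
        lem₀ : ∀ A → + 0 ≡ A - (A - + 0)
        lem₀ = solve-∀
      s≅0 : s ≅ + 0 [ m ]
      s≅0 = ≅-weaken (divides b refl) (halve 2s≅0)
      -- For A = 2k the vertex at position k is fixed, so s vanishes modulo `N` and A - z ≅ z for
      -- all z; z = 0 and z = 1 contradict each other.
      even-case : ∀ k → A ≡ + 0 + k * + 2 → ⊥
      even-case k e = 2≇0 (≅-via (minus-≅ (idx (+ 0)) (idx (+ 1))) (lem A))
        where
        fixed : at k + s ≅ at k [ N ]
        fixed = ≅-trans (refl-A k) (≅-reflexive (cong at (trans (cong (_- k) e) (lem₀ k))))
          where
          lem₀ : ∀ k → (+ 0 + k * + 2) - k ≡ k
          lem₀ = solve-∀
        s≅0ᴺ : s ≅ + 0 [ N ]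
        s≅0ᴺ = +-cancelˡ-≅ (at k) (≅-trans fixed (≅-reflexive (sym (ℤₚ.+-identityʳ (at k)))))
        idx : ∀ z → A - z ≅ z [ N ]
        idx z = at-injective (≅-trans (≅-sym (refl-A z))
            (≅-trans (+-≅ (≅-refl {x = at z}) s≅0ᴺ) (≅-reflexive (ℤₚ.+-identityʳ (at z)))))
        lem : ∀ A → + 2 - + 0 ≡ ((A - + 0) - (A - + 1)) - (+ 0 - + 1)
        lem = solve-∀
      -- For A = 2k + 1 the ends of the edge at position k are exchanged, so they differ by s, a
      -- multiple of `m`.
      odd-case : ∀ k → A ≡ + 1 + k * + 2 → ⊥
      odd-case k e = at-adjacent k (≅-trans (≅-sym
          (≅-trans (+-≅ (≅-refl {x = at k}) s≅0) (≅-reflexive (ℤₚ.+-identityʳ (at k)))))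
        (≅-weaken (divides n (ℕₚ.*-comm m n)) (≅-trans (refl-A k)
            (≅-reflexive (cong at (trans (cong (_- k) e) (lem₀ k)))))))
        where
        lem₀ : ∀ k → (+ 1 + k * + 2) - k ≡ k + + 1
        lem₀ = solve-∀
      go : ∀ ρ → ρ < 2 → A ≡ + ρ + k * + 2 → ⊥
      go zero _ e = even-case k e
      go (suc zero) _ e = odd-case k e
      go (suc (suc _)) (s≤s (s≤s ())) e

    no-reversal : ∀ {s} → Invariant s → ∀ i i′ → at i + s ≅ at (i′ + + 1) [ N ] → at (i + + 1) + s ≅ at
        i′ [ N ] → ⊥
    no-reversal {s} inv i i′ p q = no-reflection (i′ + + 1 + i) λ z → ≅-trans
      (propagate (inj₂ refl) inv i (i′ + + 1) p (≅-trans q (≅-reflexive (cong at (lem₀ i′)))) z)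
          (≅-reflexive (cong at (lem i i′ z)))
      where
      lem₀ : ∀ i → i ≡ i + + 1 + - (+ 1)
      lem₀ = solve-∀
      lem : ∀ i i′ z → i′ + + 1 + - (+ 1) * (z - i) ≡ i′ + + 1 + i - z
      lem = solve-∀

    Invariant⇒Periodic : ∀ {s} → Invariant s → ∃ λ ρ → Periodic ρ s
    Invariant⇒Periodic {s} inv with inv _ _ (inj₁ (at-edge (+ 0)))
    ... | inj₁ (step i sx sy) = + i - + 0 , rotation inv (+ 0) (+ i) (≅-sym sx)
        (≅-trans (≅-sym sy) (≅-reflexive (cong at (ℤₚ.+-comm (+ 1) (+ i)))))
    ... | inj₂ (step i sy sx) = ⊥-elim (no-reversal inv (+ 0) (+ i)
        (≅-trans (≅-sym sx) (≅-reflexive (cong at (ℤₚ.+-comm (+ 1) (+ i))))) (≅-sym sy))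

    -- The translation by H has order two, so the rotation ρ that it induces satisfies 2ρ ≅ 0 and ρ
    -- ≇ 0. The only such residue modulo N = 2H is H.
    Periodic-half : Invariant (+ H) → Periodic (+ H) (+ H)
    Periodic-half inv with Invariant⇒Periodic inv
    ... | ρ , per = periodic λ z → ≅-trans (≅-reflexive (at-cong (+-≅ (≅-refl {x = z}) (≅-sym ρ≅H))))
        (at-+ per z)
      where
      2H≅0 : + H + + H ≅ + 0 [ N ]
      2H≅0 = by (+ 1) (trans (lem (+ H)) (cong (λ z → + 0 + + 1 * z)
          (trans (sym (ℤₚ.pos-* H 2)) (cong +_ (sym N≡H*2)))))
        where
        lem : ∀ h → h + h ≡ + 0 + + 1 * (h * + 2)
        lem = solve-∀
      2ρ≅0 : ρ + ρ ≅ + 0 [ N ]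
      2ρ≅0 = at-injective (≅-trans (≅-reflexive (cong at (sym (ℤₚ.+-identityˡ (ρ + ρ)))))
          (≅-trans (at-+ (Periodic-+ per per) (+ 0))
               (≅-trans (+-≅ (≅-refl {x = at (+ 0)}) 2H≅0) (≅-reflexive (ℤₚ.+-identityʳ _)))))
      H≢0 : H ≢ 0
      H≢0 e = ℕ.≢-nonZero⁻¹ N (trans N≡H*2 (cong (ℕ._* 2) e))
      H<N : H < N
      H<N = subst (H <_) (sym N≡H*2) (ℕₚ.m<m*n H 2 {{ℕ.≢-nonZero H≢0}} (s≤s (s≤s z≤n)))
      H≇0 : ¬ (+ H ≅ + 0 [ N ])
      H≇0 p = H≢0 (≅⇒≡ H<N (ℕₚ.≤-<-trans z≤n H<N) p)
      ρ≇0 : ¬ (ρ ≅ + 0 [ N ])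
      ρ≇0 p = H≇0 (+-cancelˡ-≅ (at (+ 0)) (≅-trans (≅-sym (at-+ per (+ 0)))
          (≅-reflexive (trans (at-cong (+-≅ (≅-refl {x = + 0}) p)) (sym (ℤₚ.+-identityʳ _))))))
      even-odd : ∀ x → x %ℕ 2 ≡ 0 ⊎ x %ℕ 2 ≡ 1
      even-odd x = go (x %ℕ 2) (n%ℕd<d x 2)
        where
        go : ∀ y → y < 2 → y ≡ 0 ⊎ y ≡ 1
        go zero _ = inj₁ refl
        go (suc zero) _ = inj₂ refl
        go (suc (suc _)) (s≤s (s≤s ()))
      ρ≅H : ρ ≅ + H [ N ]
      ρ≅H with halve 2ρ≅0
      ... | by k e with even-odd k
      ... | inj₁ k0 = ⊥-elim (ρ≇0 (by (k /ℕ 2) (trans e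
          (cong (λ z → + 0 + z) (trans (cong (_* + H)
          (trans (a≡a%ℕn+[a/ℕn]*n k 2) (cong (λ z → + z + k /ℕ 2 * + 2) k0)))
          (trans (lem (k /ℕ 2) (+ H)) (cong (k /ℕ 2 *_)
          (trans (sym (ℤₚ.pos-* H 2)) (cong +_ (sym N≡H*2))))))))))
        where
        lem : ∀ k h → (+ 0 + k * + 2) * h ≡ k * (h * + 2)
        lem = solve-∀
      ... | inj₂ k1 = by (k /ℕ 2) (trans e (trans (cong (λ z → + 0 + z * + H)
          (trans (a≡a%ℕn+[a/ℕn]*n k 2) (cong (λ z → + z + k /ℕ 2 * + 2) k1)))
          (trans (lem (k /ℕ 2) (+ H)) (cong (λ z → + H + k /ℕ 2 * z)
          (trans (sym (ℤₚ.pos-* H 2)) (cong +_ (sym N≡H*2)))))))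
        where
        lem : ∀ k h → + 0 + (+ 1 + k * + 2) * h ≡ h + k * (h * + 2)
        lem = solve-∀

-- Sums modulo 2

sum-false : ∀ {n} {f : Fin n → Bool} → (∀ i → f i ≡ false) → sum f ≡ false
sum-false {n} h = trans (sum-cong-≗ h) (sum-replicate-zero n)

sum-unique : ∀ {n} {f : Fin n → Bool} i → (∀ j → j ≢ i → f j ≡ false) → sum f ≡ f i
sum-unique {f = f} Fin.zero h = trans (cong (f Fin.zero xor_) (sum-false λ j → h (Fin.suc j) λ ()))
    (xor-identityʳ (f Fin.zero))
sum-unique {f = f} (Fin.suc i) h = trans (cong (_xor sum (f ∘ Fin.suc)) (h Fin.zero λ ()))
  (sum-unique i λ j j≢i → h (Fin.suc j) λ e → j≢i (Finₚ.suc-injective e))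

∧-sum : ∀ {n} x (f : Fin n → Bool) → x ∧ sum f ≡ sum (λ i → x ∧ f i)
∧-sum true f = refl
∧-sum {n} false f = sym (sum-replicate-zero n)

-- The changes of `p` telescope to `p r xor p 0`, and the r negations contribute the parity of r.
sum-telescope : ∀ r (p : ℕ → Bool) → sum {r} (λ i → not (p (suc (toℕ i)) xor p (toℕ i))) ≡ not (even r)
    xor (p r xor p 0)
sum-telescope zero p with p 0
... | true = refl
... | false = refl
sum-telescope (suc r) p = trans (cong (not (p 1 xor p 0) xor_) (sum-telescope r (p ∘ suc)))
    (lem (even r) (p (suc r)) (p 1) (p 0))
  where
  lem : ∀ e x y z → not (y xor z) xor (not e xor (x xor y)) ≡ not (not e) xor (x xor z)
  lem true true true true = refl
  lem true true true false = refl
  lem true true false true = refl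
  lem true true false false = refl
  lem true false true true = refl
  lem true false true false = refl
  lem true false false true = refl
  lem true false false false = refl
  lem false true true true = refl
  lem false true true false = refl
  lem false true false true = refl
  lem false true false false = refl
  lem false false true true = refl
  lem false false true false = refl
  lem false false false true = refl
  lem false false false false = refl

sum-true : ∀ n → sum {n} (λ _ → true) ≡ not (even n)
sum-true zero = refl
sum-true (suc n) = cong not (sum-true n)

-- One of 1, 2, 3 is even, and every further block of four numbers contains two even ones.
sum-even-suc : ∀ x → sum {3 ℕ.+ x ℕ.* 4} (λ i → even (suc (toℕ i))) ≡ true
sum-even-suc zero = refl
sum-even-suc (suc x) = trans (cong (λ s → (true xor (false xor (true xor s))))
    (sum-cong-≗ {3 ℕ.+ x ℕ.* 4} λ i → periodic-4 (suc (toℕ i))))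
    (cong (λ s → (true xor (false xor (true xor s)))) (sum-even-suc x))
  where
  periodic-4 : ∀ i → even (4 ℕ.+ i) ≡ even i
  periodic-4 i = trans (not-involutive _) (not-involutive (even i))

least : ∀ {P : ℕ → Set} → (∀ i → Dec (P i)) → ∀ n → P n → ∃ λ r → P r × (∀ i → P i → r ≤ i)
least P? n p with P? 0
least P? n p | yes p₀ = 0 , p₀ , λ _ _ → z≤n
least P? zero p | no ¬p₀ = ⊥-elim (¬p₀ p)
least {P} P? (suc n) p | no ¬p₀ with least (P? ∘ suc) n p
... | r , pᵣ , min = suc r , pᵣ , λ { zero p₀ → ⊥-elim (¬p₀ p₀) ; (suc i) pᵢ → s≤s (min i pᵢ) }

leastᶠ : ∀ {k} {P : Fin k → Set} → (∀ j → Dec (P j)) → ∃ P → ∃ λ j → P j × (∀ j′ → P j′ → j Fin.≤ j′)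
leastᶠ {suc k} P? (j , p) with P? Fin.zero
leastᶠ {suc k} P? (j , p) | yes p₀ = Fin.zero , p₀ , λ _ _ → z≤n
leastᶠ {suc k} P? (Fin.zero , p) | no ¬p₀ = ⊥-elim (¬p₀ p)
leastᶠ {suc k} P? (Fin.suc j , p) | no ¬p₀ with leastᶠ (P? ∘ Fin.suc) (j , p)
... | r , pᵣ , min = Fin.suc r , pᵣ , λ { Fin.zero p₀ → ⊥-elim (¬p₀ p₀) ; (Fin.suc i) pᵢ → s≤s (min i pᵢ) }

module _ {N : ℕ} .{{_ : NonZero N}} where

  ≅-dec : ∀ x y → Dec (x ≅ y [ N ])
  ≅-dec x y = map′ (λ e → ≅-trans (≅-sym (%ℕ-≅ x)) (≅-trans (≅-reflexive (cong +_ e)) (%ℕ-≅ y)))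
    (λ p → ≅⇒≡ (n%ℕd<d x N) (n%ℕd<d y N) (≅-trans (%ℕ-≅ x) (≅-trans p (≅-sym (%ℕ-≅ y)))))
    (x %ℕ N ℕ.≟ y %ℕ N)

  ≅±-dec : ∀ x y → Dec (x ≅± y [ N ])
  ≅±-dec x y = ≅-dec x y ⊎-dec ≅-dec x (- y)

≅⇒even : ∀ x y → + x ≅ + y [ 2 ] → even x ≡ even y
≅⇒even x y p with even x in ex | even y in ey
... | true  | true  = refl
... | false | false = refl
... | true  | false = ⊥-elim (0≇1 (≅-trans (≅-sym (even⇒≅0 x ex)) (≅-trans p (odd⇒≅1 y ey))))
... | false | true  = ⊥-elim (0≇1 (≅-trans (≅-sym (even⇒≅0 y ey)) (≅-trans (≅-sym p) (odd⇒≅1 x ex))))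

-- Edges and translations in a given system

module Necessity (m′ n k : ℕ) .{{N≢0 : NonZero (suc m′ ℕ.* n)}} (C : Fin k → ℕ → ℕ)
  (hcs : HCS (suc m′) n k C) (cyclic : Cyclic (suc m′) n k C) (symmetric : PhiSymmetric (suc m′) n k C) where

  private
    m N : ℕ
    m = suc m′
    N = m ℕ.* n

  open HCS hcs

  module _ (j : Fin k) where
    open Ham m n (C j) (hamiltonian j) public

  m∣N : m ∣ N
  m∣N = divides n (ℕₚ.*-comm m n)

  LinkIn : Fin k → ℤ → ℤ → Set
  LinkIn j = Link N (walk j)

  Step⇒diff : ∀ {j x y} → Step N (walk j) x y → ∃ λ z → diff j z ≅ y - x [ N ]
  Step⇒diff {j} (step i sx sy) = + i , minus-≅ (≅-trans
      (≅-reflexive (cong (at j) (ℤₚ.+-comm (+ i) (+ 1)))) sy) sx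

  Link⇒diff : ∀ {j x y} → LinkIn j x y → ∃ λ z → diff j z ≅± y - x [ N ]
  Link⇒diff (inj₁ t) = let z , p = Step⇒diff t in z , inj₁ p
  Link⇒diff {x = x} {y} (inj₂ t) = let z , p = Step⇒diff t in z , inj₂ (≅-trans p (≅-reflexive (lem x y)))
    where
    lem : ∀ x y → x - y ≡ - (y - x)
    lem = solve-∀

  diff≇0 : ∀ j z → ¬ (diff j z ≅ + 0 [ m ])
  diff≇0 j z p = at-adjacent j z (≅-via⁻ p (lem (at j z) (at j (z + + 1))))
    where
    lem : ∀ u v → u - v ≡ + 0 - (v - u)
    lem = solve-∀

  Link⇒≇ : ∀ {j x y} → LinkIn j x y → ¬ (x ≅ y [ m ])
  Link⇒≇ {j} {x} {y} l p = let z , d = Link⇒diff l in [ (λ q → diff≇0 j z (≅-trans (≅-weaken m∣N q) y-x≅0)) , (λ q → diff≇0 j z (≅-trans (≅-weaken m∣N q) (neg-≅ y-x≅0))) ]′ d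
    where
    lem : ∀ x y → (y - x) - + 0 ≡ y - x
    lem = solve-∀
    y-x≅0 : y - x ≅ + 0 [ m ]
    y-x≅0 = ≅-via (≅-sym p) (lem x y)

  Link-exists : ∀ {x y} → ¬ (x ≅ y [ m ]) → Σ (Fin k) λ j → LinkIn j x y × (∀ j′ → LinkIn j′ x y → j′ ≡ j)
  Link-exists {x} {y} x≇y =
    let j , i , u = partition (x %ℕ N) (y %ℕ N) (n%ℕd<d x N) (n%ℕd<d y N)
          (≇⇒Adj m λ p → x≇y (≅-trans (≅-weaken m∣N (≅-sym (%ℕ-≅ x))) (≅-trans p (≅-weaken m∣N (%ℕ-≅ y)))))
    in j , Link-≅ (%ℕ-≅ x) (%ℕ-≅ y) (InCycle⇒Link (C-Lift j) i) ,
       λ j′ l → u j′ (Link⇒InCycle (C-Lift j′) (n%ℕd<d x N) (n%ℕd<d y N)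
           (Link-≅ (≅-sym (%ℕ-≅ x)) (≅-sym (%ℕ-≅ y)) l))

  Link-unique : ∀ {j j′ x y} → LinkIn j x y → LinkIn j′ x y → j ≡ j′
  Link-unique l l′ = let _ , _ , u = Link-exists (Link⇒≇ l) in trans (u _ l) (sym (u _ l′))

  translate : ∀ s j → ∃ λ j′ → ∀ x y → LinkIn j x y → LinkIn j′ (x + + s) (y + + s)
  translate zero j = j , λ x y → Link-≅ (≅-reflexive (sym (ℤₚ.+-identityʳ x)))
      (≅-reflexive (sym (ℤₚ.+-identityʳ y)))
  translate (suc s) j =
    let j₁ , f = translate s j
        j₂ , same = cyclic j₁
    in j₂ , λ x y l → Link-≅ (≅-reflexive (lem x (+ s))) (≅-reflexive (lem y (+ s)))
         (SameCycle⇒Link (shift-Lift 1 (C-Lift j₁)) (C-Lift j₂)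
             (λ x y → mk⇔ (Equivalence.from (same x y)) (Equivalence.to (same x y)))
             (Link-+ (+ 1) (f x y l)))
    where
    lem : ∀ x s → x + s + + 1 ≡ x + (+ 1 + s)
    lem = solve-∀

  invariant-m : ∀ j q → Invariant j (+ (q ℕ.* m))
  invariant-m j zero x y = Link-≅ (≅-reflexive (sym (ℤₚ.+-identityʳ x)))
      (≅-reflexive (sym (ℤₚ.+-identityʳ y)))
  invariant-m j (suc q) x y l = Link-≅ (≅-reflexive (lem x (+ (q ℕ.* m)) (+ m)))
      (≅-reflexive (lem y (+ (q ℕ.* m)) (+ m)))
    (SameCycle⇒Link (shift-Lift m (C-Lift j)) (C-Lift j) (symmetric j)
        (Link-+ (+ m) (invariant-m j q x y l)))
    where
    lem : ∀ x s m → x + s + m ≡ x + (m + s)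
    lem = solve-∀

  -- Evenness of n from the neighbours of the vertex 0

  module EvenDegree where

    -- Taken with modulus 2N and n rows, so that `repℕ` runs through all numbers below N not
    -- divisible by `m`: these are the neighbours of 0, not the classes up to sign.
    open Classes m′ n (n ℕ.* m ℕ.+ n ℕ.* m) refl using (repℕ; repℕ-surjective; rep≇0)

    zeroAt : Fin k → ℤ
    zeroAt j = proj₁ (at-surjective j (+ 0))

    side : Fin 2 → ℤ
    side Fin.zero    = + 1
    side (Fin.suc _) = - (+ 1)

    nbr : Fin k → Fin 2 → ℤ
    nbr j β = at j (zeroAt j + side β)

    nbr-Link : ∀ j β → LinkIn j (+ 0) (nbr j β)
    nbr-Link j Fin.zero = Link-≅ (proj₂ (at-surjective j (+ 0))) ≅-refl (inj₁ (at-edge j (zeroAt j)))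
    nbr-Link j (Fin.suc Fin.zero) = Link-≅ (≅-trans (≅-reflexive (cong (at j) (lem (zeroAt j))))
        (proj₂ (at-surjective j (+ 0)))) ≅-refl (inj₂ (at-edge j (zeroAt j - + 1)))
      where
      lem : ∀ z → z - + 1 + + 1 ≡ z
      lem = solve-∀

    Link⇒nbr : ∀ j {y} → LinkIn j (+ 0) y → ∃ λ β → y ≅ nbr j β [ N ]
    Link⇒nbr j l = [ (λ p → Fin.zero , p) , (λ p → Fin.suc Fin.zero , p) ]′
      (neighbour j (zeroAt j) l (≅-sym (proj₂ (at-surjective j (+ 0)))))

    nbr-injective : ∀ j β β′ → nbr j β ≅ nbr j β′ [ N ] → β ≡ β′
    nbr-injective j β β′ p = side-injective β β′ (+-cancelˡ-≅ (zeroAt j) (at-injective j p))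
      where
      side-injective : ∀ β β′ → side β ≅ side β′ [ N ] → β ≡ β′
      side-injective Fin.zero Fin.zero p = refl
      side-injective Fin.zero (Fin.suc Fin.zero) p = ⊥-elim (2≇0 j (≅-via p refl))
      side-injective (Fin.suc Fin.zero) Fin.zero p = ⊥-elim (2≇0 j (≅-via⁻ p refl))
      side-injective (Fin.suc Fin.zero) (Fin.suc Fin.zero) p = refl

    nbr-unique : ∀ j β j′ β′ → nbr j β ≅ nbr j′ β′ [ N ] → combine j β ≡ combine j′ β′
    nbr-unique j β j′ β′ p = go (Link-unique {j} {j′} {+ 0} {nbr j β} (nbr-Link j β)
        (Link-≅ {x = + 0} ≅-refl (≅-sym p) (nbr-Link j′ β′))) p
      where
      go : j ≡ j′ → nbr j β ≅ nbr j′ β′ [ N ] → combine j β ≡ combine j′ β′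
      go refl p = cong (combine j) (nbr-injective j β β′ p)

    opaque
      toRep : ∀ j β → ∃ λ q → ∃ λ ρ → + repℕ q ρ ≅ nbr j β [ N ]
      toRep j β = let q , ρ , e = repℕ-surjective (y %ℕ N) (subst (y %ℕ N <_) (ℕₚ.*-comm m n) (n%ℕd<d y N))
                         (λ p → Link⇒≇ {j} {+ 0} {y} (nbr-Link j β)
                             (≅-sym (≅-trans (≅-weaken m∣N (≅-sym (%ℕ-≅ y))) p)))
                  in q , ρ , ≅-trans (≅-reflexive (cong +_ e)) (%ℕ-≅ y)
        where
        y : ℤ
        y = nbr j β

      fromRep : ∀ q ρ → ∃ λ j → ∃ λ β → + repℕ q ρ ≅ nbr j β [ N ]
      fromRep q ρ = let j , l , _ = Link-exists {+ 0} {+ repℕ q ρ} (λ p → rep≇0 q ρ (≅-sym p)) ; β , e = Link⇒nbr j {+ repℕ q ρ} l in j , β , e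

    f : Fin (k ℕ.* 2) → Fin (n ℕ.* m′)
    f x = let j , β = remQuot {k} 2 x ; q , ρ , _ = toRep j β in combine q ρ

    f-injective : ∀ {x x′} → f x ≡ f x′ → x ≡ x′
    f-injective {x} {x′} e = trans (sym (Finₚ.combine-remQuot {k} 2 x))
        (trans (go (remQuot {k} 2 x) (remQuot {k} 2 x′) e) (Finₚ.combine-remQuot {k} 2 x′))
      where
      go : ∀ z z′ → (let q , ρ , _ = toRep (proj₁ z) (proj₂ z) in combine q ρ) ≡ (let q , ρ , _ = toRep (proj₁ z′) (proj₂ z′) in combine q ρ) →
        combine (proj₁ z) (proj₂ z) ≡ combine (proj₁ z′) (proj₂ z′)
      go (j , β) (j′ , β′) e = same (toRep j β) (toRep j′ β′) e
        where
        Rep : Fin k → Fin 2 → Set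
        Rep j β = ∃ λ q → ∃ λ ρ → + repℕ q ρ ≅ nbr j β [ N ]
        same : (z : Rep j β) (z′ : Rep j′ β′) → combine (proj₁ z) (proj₁ (proj₂ z)) ≡ combine (proj₁ z′)
            (proj₁ (proj₂ z′)) →
          combine j β ≡ combine j′ β′
        same (q , ρ , p) (q′ , ρ′ , p′) e = nbr-unique j β j′ β′ (≅-trans (≅-sym p)
          (≅-trans (≅-reflexive (cong₂ (λ q ρ → + repℕ q ρ) (proj₁ eqs) (proj₂ eqs))) p′))
          where
          eqs : q ≡ q′ × ρ ≡ ρ′
          eqs = Finₚ.combine-injective q ρ q′ ρ′ e

    g : Fin (n ℕ.* m′) → Fin (k ℕ.* 2)
    g x = let q , ρ = remQuot {n} m′ x ; j , β , _ = fromRep q ρ in combine j β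

    g-injective : ∀ {x x′} → g x ≡ g x′ → x ≡ x′
    g-injective {x} {x′} e = trans (sym (Finₚ.combine-remQuot {n} m′ x))
        (trans (go (remQuot {n} m′ x) (remQuot {n} m′ x′) e) (Finₚ.combine-remQuot {n} m′ x′))
      where
      repℕ<N : ∀ q ρ → repℕ q ρ < N
      repℕ<N q ρ = subst (repℕ q ρ <_) (ℕₚ.*-comm n m) (Finₚ.toℕ<n (combine q (Fin.suc ρ)))
      go : ∀ z z′ → (let j , β , _ = fromRep (proj₁ z) (proj₂ z) in combine j β) ≡ (let j , β , _ = fromRep (proj₁ z′) (proj₂ z′) in combine j β) →
        combine (proj₁ z) (proj₂ z) ≡ combine (proj₁ z′) (proj₂ z′)
      go (q , ρ) (q′ , ρ′) e = same (fromRep q ρ) (fromRep q′ ρ′) e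
        where
        Side : Fin n → Fin m′ → Set
        Side q ρ = ∃ λ j → ∃ λ β → + repℕ q ρ ≅ nbr j β [ N ]
        same : (z : Side q ρ) (z′ : Side q′ ρ′) → combine (proj₁ z) (proj₁ (proj₂ z)) ≡ combine (proj₁ z′)
            (proj₁ (proj₂ z′)) →
          combine q ρ ≡ combine q′ ρ′
        same (j , β , p) (j′ , β′ , p′) e = cong₂ combine (proj₁ reps) (Finₚ.suc-injective (proj₂ reps))
          where
          eqs : j ≡ j′ × β ≡ β′
          eqs = Finₚ.combine-injective j β j′ β′ e
          reps : q ≡ q′ × Fin.suc ρ ≡ Fin.suc ρ′
          reps = Finₚ.combine-injective q (Fin.suc ρ) q′ (Fin.suc ρ′)
              (Finₚ.toℕ-injective (≅⇒≡ (repℕ<N q ρ) (repℕ<N q′ ρ′)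
            (≅-trans p (≅-trans (≅-reflexive (cong₂ nbr (proj₁ eqs) (proj₂ eqs))) (≅-sym p′)))))

    -- Both sides count the edges at 0, by cycle and side or by the other end. Each description
    -- determines the other, which gives the injections `f` and `g`.
    degree : k ℕ.* 2 ≡ n ℕ.* m′
    degree = ℕₚ.≤-antisym (Finₚ.injective⇒≤ {f = f} f-injective) (Finₚ.injective⇒≤ {f = g} g-injective)

    2∣n : 2 ∣ m → 2 ∣ n
    2∣n 2∣m = ∣m+n∣m⇒∣n (subst (2 ∣_) (trans (ℕₚ.*-suc n m′) (ℕₚ.+-comm n (n ℕ.* m′)))
        (subst (2 ∣_) (ℕₚ.*-comm m n) (∣m⇒∣m*n n 2∣m))) (divides k (sym degree))

-- Parity of the number of even classes

module EvenClasses (m′ n k : ℕ) .{{N≢0 : NonZero (suc m′ ℕ.* n)}} (C : Fin k → ℕ → ℕ)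
  (hcs : HCS (suc m′) n k C) (cyclic : Cyclic (suc m′) n k C) (symmetric : PhiSymmetric (suc m′) n k C)
  (b : ℕ) (n≡b+b : n ≡ b ℕ.+ b) (2∣m : 2 ∣ suc m′) where

  open ≡-Reasoning
  open Necessity m′ n k C hcs cyclic symmetric hiding (H)

  private
    m N : ℕ
    m = suc m′
    N = m ℕ.* n

    H : ℕ
    H = b ℕ.* m

    N≡ : N ≡ b ℕ.* m ℕ.+ b ℕ.* m
    N≡ = trans (cong (m ℕ.*_) n≡b+b) (trans (ℕₚ.*-comm m (b ℕ.+ b)) (ℕₚ.*-distribʳ-+ m b b))

    2∣N : 2 ∣ N
    2∣N = ∣m⇒∣m*n n 2∣m

    H≢0 : H ≢ 0
    H≢0 e = ℕ.≢-nonZero⁻¹ N (trans N≡ (cong₂ ℕ._+_ e e))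

  open Classes m′ b N N≡ using (rep; repℕ; repℕ≡; rep-injective; rep-surjective; rep≇0)

  Aligned : Fin k → Fin k → ℤ → ℤ → Set
  Aligned j j′ i i′ = ∃ λ s → (∀ x y → LinkIn j x y → LinkIn j′ (x + s) (y + s)) ×
    ((at j i + s ≅ at j′ i′ [ N ] × at j (i + + 1) + s ≅ at j′ (i′ + + 1) [ N ]) ⊎
     (at j i + s ≅ at j′ (i′ + + 1) [ N ] × at j (i + + 1) + s ≅ at j′ i′ [ N ]))

  -- Edges of the same class differ by a translation. It carries the cycle j to some cycle of the
  -- system, which is j′ because an edge lies in only one cycle.
  align : ∀ {j j′} i i′ → diff j i ≅± diff j′ i′ [ N ] → Aligned j j′ i i′
  align {j} {j′} i i′ = [ direct , reversed ]′
    where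
    shift-to : ∀ u v → u + + ((v - u) %ℕ N) ≅ v [ N ]
    shift-to u v = ≅-via (%ℕ-≅ (v - u)) (lem u v (+ ((v - u) %ℕ N)))
      where
      lem : ∀ u v s → (u + s) - v ≡ s - (v - u)
      lem = solve-∀
    fix : ∀ s u v → at j i + + s ≅ u [ N ] → at j (i + + 1) + + s ≅ v [ N ] → LinkIn j′ u v →
      ∀ x y → LinkIn j x y → LinkIn j′ (x + + s) (y + + s)
    fix s u v p q l x y t = subst (λ j → LinkIn j (x + + s) (y + + s))
      (Link-unique {proj₁ tr} {j′} {u} {v} (Link-≅ p q
          (proj₂ tr (at j i) (at j (i + + 1)) (inj₁ (at-edge j i)))) l) (proj₂ tr x y t)
      where
      tr = translate s j
    direct : diff j i ≅ diff j′ i′ [ N ] → Aligned j j′ i i′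
    direct p = + s , fix s (at j′ i′) (at j′ (i′ + + 1)) e₁ e₂ (inj₁ (at-edge j′ i′)) , inj₁ (e₁ , e₂)
      where
      s = (at j′ i′ - at j i) %ℕ N
      e₁ : at j i + + s ≅ at j′ i′ [ N ]
      e₁ = shift-to (at j i) (at j′ i′)
      e₂ : at j (i + + 1) + + s ≅ at j′ (i′ + + 1) [ N ]
      e₂ = ≅-via (+-≅ e₁ p) (lem (at j i) (at j (i + + 1)) (at j′ i′) (at j′ (i′ + + 1)) (+ s))
        where
        lem : ∀ u u₁ v v₁ s → u₁ + s - v₁ ≡ (u + s + (u₁ - u)) - (v + (v₁ - v))
        lem = solve-∀
    reversed : diff j i ≅ - diff j′ i′ [ N ] → Aligned j j′ i i′
    reversed p = + s , fix s (at j′ (i′ + + 1)) (at j′ i′) e₁ e₂ (inj₂ (at-edge j′ i′)) , inj₂ (e₁ , e₂)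
      where
      s = (at j′ (i′ + + 1) - at j i) %ℕ N
      e₁ : at j i + + s ≅ at j′ (i′ + + 1) [ N ]
      e₁ = shift-to (at j i) (at j′ (i′ + + 1))
      e₂ : at j (i + + 1) + + s ≅ at j′ i′ [ N ]
      e₂ = ≅-via (+-≅ e₁ p) (lem (at j i) (at j (i + + 1)) (at j′ i′) (at j′ (i′ + + 1)) (+ s))
        where
        lem : ∀ u u₁ v v₁ s → u₁ + s - v ≡ (u + s + (u₁ - u)) - (v₁ + - (v₁ - v))
        lem = solve-∀

  -- A translation does not change differences, so one common class brings every class of j to j′.
  share : ∀ {j j′} i i′ → diff j i ≅± diff j′ i′ [ N ] → ∀ z → ∃ λ z′ → diff j′ z′ ≅± diff j z [ N ]
  share {j} i i′ p z = let s , f , _ = align i i′ p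
                           z′ , e = Link⇒diff (f _ _ (inj₁ (at-edge j z)))
                       in z′ , ±-trans e (inj₁ (≅-reflexive (lem (at j (z + + 1)) (at j z) s)))
    where
    lem : ∀ u v s → u + s - (v + s) ≡ u - v
    lem = solve-∀

  -- Aligning a cycle with itself gives a translation symmetry; were it orientation-reversing, it
  -- would be a reflection.
  same-diff⇒Periodic : ∀ {j} i i′ → diff j i ≅± diff j i′ [ N ] → ∃ λ s → Periodic j (i′ - i) s
  same-diff⇒Periodic {j} i i′ p = go (align {j} {j} i i′ p)
    where
    go : Aligned j j i i′ → ∃ λ s → Periodic j (i′ - i) s
    go (s , inv , inj₁ (e₁ , e₂)) = s , rotation j {s} inv i i′ e₁ e₂
    go (s , inv , inj₂ (e₁ , e₂)) = ⊥-elim (no-reversal j b n≡b+b {s} inv i i′ e₁ e₂)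

  Periodic-H : ∀ j → Periodic j (+ H) (+ H)
  Periodic-H j = Periodic-half j b n≡b+b (invariant-m j b)

  -- The candidate period is `suc i`, so that the least one found is positive.
  Return : Fin k → ℕ → Set
  Return j i = diff j (+ suc i) ≅± diff j (+ 0) [ N ]

  Return-H : ∀ j → Return j (ℕ.pred H)
  Return-H j = inj₁ (≅-trans (≅-reflexive (cong (diff j ∘ +_) (ℕₚ.suc-pred H {{ℕ.≢-nonZero H≢0}})))
    (≅-trans (≅-reflexive (cong (diff j) (sym (ℤₚ.+-identityˡ (+ H)))))
        (Periodic⇒diff j {+ H} {+ H} (Periodic-H j) (+ 0))))

  -- The least period of the sequence of difference classes of the cycle j.
  module Period (j : Fin k) where

    private abstract
      found : ∃ λ i → Return j i × (∀ i′ → Return j i′ → i ≤ i′)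
      found = least {Return j} (λ i → ≅±-dec (diff j (+ suc i)) (diff j (+ 0))) (ℕ.pred H) (Return-H j)

    r : ℕ
    r = suc (proj₁ found)

    r-least : ∀ i → 0 < i → i < r → ¬ (diff j (+ i) ≅± diff j (+ 0) [ N ])
    r-least (suc i) _ (s≤s i<r) p = ℕₚ.<⇒≱ i<r (proj₂ (proj₂ found) i p)

    r-Periodic : ∃ λ t → Periodic j (+ r) t
    r-Periodic = let t , p = same-diff⇒Periodic (+ 0) (+ r) (±-sym (proj₁ (proj₂ found))) in
      t , subst (λ ρ → Periodic j ρ t) (ℤₚ.+-identityʳ (+ r)) p

    t : ℤ
    t = proj₁ r-Periodic

    Periodic-% : ∀ {x s} → Periodic j (+ x) s → ∃ λ s′ → Periodic j (+ (x % r)) s′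
    Periodic-% {x} {s} p = s′ , subst (λ ρ → Periodic j ρ s′) eq
        (Periodic-+ j {+ x} {s} { - (+ (x / r) * + r)} { - (+ (x / r) * t)} p
          (Periodic-neg j {+ (x / r) * + r} {+ (x / r) * t}
              (Periodic-* j {+ r} {t} (proj₂ r-Periodic) (x / r))))
      where
      s′ : ℤ
      s′ = s + - (+ (x / r) * t)
      lem : ∀ a b → a + b - b ≡ a
      lem = solve-∀
      eq : + x + - (+ (x / r) * + r) ≡ + (x % r)
      eq = trans (cong (λ y → y + - (+ (x / r) * + r))
          (trans (cong +_ (ℕᵈ.m≡m%n+[m/n]*n x r)) (cong (λ y → + (x % r) + y) (ℤₚ.pos-* (x / r) r))))
             (lem (+ (x % r)) (+ (x / r) * + r))

    Periodic⇒r∣ : ∀ {x s} → Periodic j (+ x) s → x % r ≡ 0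
    Periodic⇒r∣ {x} p with x % r ℕ.≟ 0
    ... | yes e = e
    ... | no ¬e = ⊥-elim (r-least (x % r) (ℕₚ.n≢0⇒n>0 ¬e) (ℕᵈ.m%n<n x r)
      (inj₁ (≅-trans (≅-reflexive (cong (diff j) (sym (ℤₚ.+-identityˡ _))))
          (Periodic⇒diff j {+ (x % r)} {proj₁ (Periodic-% p)} (proj₂ (Periodic-% p)) (+ 0)))))

    diff-% : ∀ i → diff j (+ i) ≅ diff j (+ (i % r)) [ N ]
    diff-% i = ≅-trans (≅-reflexive (cong (diff j)
        (trans (cong +_ (ℕᵈ.m≡m%n+[m/n]*n i r)) (cong (λ y → + (i % r) + y) (ℤₚ.pos-* (i / r) r)))))
      (Periodic⇒diff j {+ (i / r) * + r} {+ (i / r) * t}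
          (Periodic-* j {+ r} {t} (proj₂ r-Periodic) (i / r)) (+ (i % r)))

    -- A repeated class would make i′ - i a period of the cycle, hence a multiple of r, although 0 <
    -- i′ - i < r.
    distinct : ∀ {i i′} → i < i′ → i′ < r → ¬ (diff j (+ i) ≅± diff j (+ i′) [ N ])
    distinct {i} {i′} i<i′ i′<r p = ℕₚ.m>n⇒m∸n≢0 i<i′
        (trans (sym (ℕᵈ.m<n⇒m%n≡m (ℕₚ.≤-<-trans (ℕₚ.m∸n≤m i′ i) i′<r)))
      (Periodic⇒r∣ {i′ ℕ.∸ i} {proj₁ per} (subst (λ ρ → Periodic j ρ (proj₁ per))
          (trans (ℤₚ.m-n≡m⊖n i′ i) (ℤₚ.⊖-≥ (ℕₚ.<⇒≤ i<i′))) (proj₂ per))))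
      where
      per : ∃ λ s → Periodic j (+ i′ - + i) s
      per = same-diff⇒Periodic (+ i) (+ i′) p

    diff-injective : ∀ i i′ → i < r → i′ < r → diff j (+ i) ≅± diff j (+ i′) [ N ] → i ≡ i′
    diff-injective i i′ i<r i′<r p with ℕₚ.<-cmp i i′
    ... | tri≈ _ e _ = e
    ... | tri< i<i′ _ _ = ⊥-elim (distinct i<i′ i′<r p)
    ... | tri> _ _ i′<i = ⊥-elim (distinct i′<i i<r (±-sym p))

    -- With H = e r, going e periods forward translates by e t and also by H, so e t ≡ e r modulo N = 2 e r.
    t≅r : t ≅ + r [ 2 ]
    t≅r = from (+-cancelˡ-≅ (at j (+ 0)) (≅-trans (≅-sym
        (Periodic.at-+ (Periodic-* j {+ r} {t} (proj₂ r-Periodic) e) (+ 0)))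
           (≅-trans (≅-reflexive (cong (λ y → at j (+ 0 + y)) (sym eH)))
               (Periodic.at-+ (Periodic-H j) (+ 0)))))
      where
      e = H / r
      H≡er : H ≡ e ℕ.* r
      H≡er = trans (ℕᵈ.m≡m%n+[m/n]*n H r) (cong (ℕ._+ e ℕ.* r) (Periodic⇒r∣ {H} {+ H} (Periodic-H j)))
      eH : + H ≡ + e * + r
      eH = trans (cong +_ H≡er) (ℤₚ.pos-* e r)
      e≢0 : e ≢ 0
      e≢0 e0 = H≢0 (trans H≡er (cong (ℕ._* r) e0))
      from : + e * t ≅ + H [ N ] → t ≅ + r [ 2 ]
      from (by q p) = by (q * + r) (ℤₚ.*-cancelˡ-≡ (+ e) _ _ {{ℤ.≢-nonZero (e≢0 ∘ ℤₚ.+-injective)}}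
          (trans p (trans (cong₂ (λ x y → x + q * y) eH (trans (cong +_ N≡) (cong₂ _+_ eH eH)))
          (lem (+ e) (+ r) q))))
        where
        lem : ∀ e r q → e * r + q * (e * r + e * r) ≡ e * (r + q * r * + 2)
        lem = solve-∀

    p : ℕ → Bool
    p i = even (C j (i % N))

    at-parity : ∀ i → at j (+ i) ≡ + C j (i % N)
    at-parity i = at-% j (+ i)

    p-return : p r ≡ even (C j (0 % N) ℕ.+ r)
    p-return = ≅⇒even _ _ (≅-trans (≅-reflexive (sym (at-parity r)))
        (≅-trans (≅-weaken 2∣N (Periodic.at-+ (proj₂ r-Periodic) (+ 0)))
      (+-≅ (≅-reflexive (at-parity 0)) t≅r)))

    evenStep : ℕ → Bool
    evenStep i = not (p (suc i) xor p i)

    -- Modulo 2 the number of odd steps in a period is the total displacement t, that is r; so the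
    -- even steps among the r steps are even in number.
    evenSteps-even : sum {r} (λ i → evenStep (toℕ i)) ≡ false
    evenSteps-even = trans (sum-telescope r p) (trans
        (cong (λ x → not (even r) xor (x xor p 0)) (trans p-return (even-+ (C j (0 % N)) r)))
        (lem (even r) (p 0)))
      where
      lem : ∀ e x → not e xor ((if x then e else not e) xor x) ≡ false
      lem true true = refl
      lem true false = refl
      lem false true = refl
      lem false false = refl

    -- Parity survives both the reduction modulo `N`, which is even, and a change of sign, so it is
    -- a property of the class.
    diff-parity : ∀ i x → diff j (+ i) ≅± + x [ N ] → even x ≡ evenStep i
    diff-parity i x d = lem (even x) (p i) (p (suc i)) (trans (≅⇒even _ _ step≅) (even-+ (C j (i % N)) x))
      where
      sign : ∀ {u} → u ≅± + x [ N ] → u ≅ + x [ 2 ]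
      sign (inj₁ q) = ≅-weaken 2∣N q
      sign (inj₂ q) = ≅-trans (≅-weaken 2∣N q) (by (- (+ x)) (l (+ x)))
        where
        l : ∀ x → - x ≡ x + - x * + 2
        l = solve-∀
      lem₀ : ∀ u v x → u - (v + x) ≡ u - v - x
      lem₀ = solve-∀
      step≅ : + C j (suc i % N) ≅ + (C j (i % N) ℕ.+ x) [ 2 ]
      step≅ = ≅-trans (≅-reflexive (trans (sym (at-parity (suc i))) (cong (at j) (ℤₚ.+-comm (+ 1) (+ i)))))
        (≅-trans (≅-via (sign d) (lem₀ (at j (+ i + + 1)) (at j (+ i)) (+ x)))
            (+-≅ (≅-reflexive (at-parity i)) ≅-refl))
      lem : ∀ e x y → y ≡ (if x then e else not e) → e ≡ not (y xor x)
      lem true true _ refl = refl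
      lem true false _ refl = refl
      lem false true _ refl = refl
      lem false false _ refl = refl

  open Period using (r; diff-%; diff-injective; evenStep; evenSteps-even; diff-parity)

  Has : Fin b → Fin m′ → Fin k → Set
  Has q ρ j = ∃ λ (i : Fin (r j)) → diff j (+ toℕ i) ≅± rep q ρ [ N ]

  opaque
    class? : ∀ j i q ρ → Dec (diff j (+ i) ≅± rep q ρ [ N ])
    class? j i q ρ = ≅±-dec (diff j (+ i)) (rep q ρ)

    has? : ∀ q ρ j → Dec (Has q ρ j)
    has? q ρ j = Finₚ.any? λ i → class? j (toℕ i) q ρ

  diff⇒Has : ∀ {q ρ j} z → diff j z ≅± rep q ρ [ N ] → Has q ρ j
  diff⇒Has {q} {ρ} {j} z p = fromℕ< i<r , ±-trans (inj₁ (≅-sym (≅-trans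
      (≅-trans (≅-reflexive (cong₂ _-_ (at-cong j (+-≅ z≅ (≅-refl {x = + 1}))) (at-cong j z≅)))
          (diff-% j (z %ℕ N)))
      (≅-reflexive (cong (diff j ∘ +_) (sym (Finₚ.toℕ-fromℕ< i<r))))))) p
    where
    i<r : (z %ℕ N) % r j < r j
    i<r = ℕᵈ.m%n<n (z %ℕ N) (r j)
    z≅ : z ≅ + (z %ℕ N) [ N ]
    z≅ = ≅-sym (%ℕ-≅ z)

  Has-exists : ∀ q ρ → ∃ (Has q ρ)
  Has-exists q ρ = let j , l , _ = Link-exists {+ 0} {rep q ρ} (λ p → rep≇0 q ρ (≅-sym p))
                       z , e = Link⇒diff l
                   in j , diff⇒Has z (±-trans e (inj₁ (≅-reflexive (ℤₚ.+-identityʳ (rep q ρ)))))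

  opaque
    -- A class occurs on a cycle together with the translates of that cycle. The one of least index
    -- is singled out, so that each class is counted once.
    owned : ∀ q ρ → ∃ λ j → Has q ρ j × (∀ j′ → Has q ρ j′ → j Fin.≤ j′)
    owned q ρ = leastᶠ (has? q ρ) (Has-exists q ρ)

  owner : Fin b → Fin m′ → Fin k
  owner q ρ = proj₁ (owned q ρ)

  -- Both owners contain the class (q, ρ), so by `share` each contains both classes, and minimality
  -- of the index works in both directions.
  Has⇒owner : ∀ {q₀ ρ₀ q ρ} → Has q ρ (owner q₀ ρ₀) → owner q ρ ≡ owner q₀ ρ₀
  Has⇒owner {q₀} {ρ₀} {q} {ρ} h@(i , d) = Finₚ.≤-antisym (proj₂ (proj₂ (owned q ρ)) _ h)
      (proj₂ (proj₂ (owned q₀ ρ₀)) _ h₀)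
    where
    h₀ : Has q₀ ρ₀ (owner q ρ)
    h₀ = let i′ , d′ = proj₁ (proj₂ (owned q ρ))
             i₀ , d₀ = proj₁ (proj₂ (owned q₀ ρ₀))
             z , e = share (+ toℕ i) (+ toℕ i′) (±-trans d (±-sym d′)) (+ toℕ i₀)
         in diff⇒Has z (±-trans e d₀)

  ∑∑ : (Fin b → Fin m′ → Bool) → Bool
  ∑∑ f = sum λ q → sum (f q)

  ∑∑-cong : ∀ {f g} → (∀ q ρ → f q ρ ≡ g q ρ) → ∑∑ f ≡ ∑∑ g
  ∑∑-cong h = sum-cong-≗ λ q → sum-cong-≗ (h q)

  ∑∑-comm : ∀ {l} (f : Fin b → Fin m′ → Fin l → Bool) → ∑∑ (λ q ρ → sum (f q ρ)) ≡ sum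
      (λ j → ∑∑ λ q ρ → f q ρ j)
  ∑∑-comm f = trans (sum-cong-≗ λ q → ∑-comm (f q)) (∑-comm λ q j → sum λ ρ → f q ρ j)

  isEven : Fin b → Fin m′ → Bool
  isEven q ρ = even (repℕ q ρ)

  class-sum : ∀ j (i : Fin (r j)) → ∑∑ (λ q ρ → isEven q ρ ∧ does (class? j (toℕ i) q ρ)) ≡ evenStep j
      (toℕ i)
  class-sum j i = go (rep-surjective (diff j (+ toℕ i)) (diff≇0 j (+ toℕ i)))
    where
    go : (∃ λ q → ∃ λ ρ → diff j (+ toℕ i) ≅± rep q ρ [ N ]) →
      ∑∑ (λ q ρ → isEven q ρ ∧ does (class? j (toℕ i) q ρ)) ≡ evenStep j (toℕ i)
    go (q₀ , ρ₀ , d) = trans (sum-unique q₀ λ q q≢ → sum-false λ ρ → off q ρ (q≢ ∘ cong proj₁))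
        (trans (sum-unique ρ₀ λ ρ ρ≢ → off q₀ ρ (ρ≢ ∘ cong proj₂))
          (trans (cong (isEven q₀ ρ₀ ∧_) (dec-true (class? j (toℕ i) q₀ ρ₀) d))
            (trans (∧-identityʳ (isEven q₀ ρ₀)) (diff-parity j (toℕ i) (repℕ q₀ ρ₀) d))))
      where
      off : ∀ q ρ → (q , ρ) ≢ (q₀ , ρ₀) → isEven q ρ ∧ does (class? j (toℕ i) q ρ) ≡ false
      off q ρ ne = trans (cong (isEven q ρ ∧_) (dec-false (class? j (toℕ i) q ρ)
        λ p → ne (rep-injective {q} {q₀} {ρ} {ρ₀} (±-trans (±-sym p) d)))) (∧-zeroʳ (isEven q ρ))

  -- For a cycle that owns some class, containing a class and owning it are the same. A class sits
  -- at no more than one index of the period, so the sum modulo 2 has at most one true term.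
  indicator : ∀ j q₀ ρ₀ → owner q₀ ρ₀ ≡ j → ∀ q ρ →
    does (owner q ρ Fin.≟ j) ≡ sum {r j} (λ i → does (class? j (toℕ i) q ρ))
  indicator j q₀ ρ₀ refl q ρ = go (has? q ρ j)
    where
    go : Dec (Has q ρ j) → does (owner q ρ Fin.≟ j) ≡ sum {r j} (λ i → does (class? j (toℕ i) q ρ))
    go (yes (i , d)) = trans (dec-true (owner q ρ Fin.≟ j) (Has⇒owner {q₀} {ρ₀} {q} {ρ} (i , d)))
        (sym (trans
          (sum-unique i λ i′ ne → dec-false (class? j (toℕ i′) q ρ) λ d′ →
            ne (Finₚ.toℕ-injective (diff-injective j (toℕ i′) (toℕ i) (Finₚ.toℕ<n i′) (Finₚ.toℕ<n i)
                (±-trans d′ (±-sym d)))))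
          (dec-true (class? j (toℕ i) q ρ) d)))
    go (no ¬h) = trans (dec-false (owner q ρ Fin.≟ j) λ e → ¬h
        (subst (Has q ρ) e (proj₁ (proj₂ (owned q ρ)))))
          (sym (sum-false λ i → dec-false (class? j (toℕ i) q ρ) λ d → ¬h (i , d)))

  -- If j owns a class, exchanging the sums turns the count of its even classes into the count of
  -- its even steps in one period. If it owns none, all terms are false.
  owned-sum : ∀ j → ∑∑ (λ q ρ → isEven q ρ ∧ does (owner q ρ Fin.≟ j)) ≡ false
  owned-sum j = go (Finₚ.any? (λ q → Finₚ.any? (λ ρ → owner q ρ Fin.≟ j)))
    where
    go : Dec (∃ λ q → ∃ λ ρ → owner q ρ ≡ j) → ∑∑ (λ q ρ → isEven q ρ ∧ does (owner q ρ Fin.≟ j)) ≡ false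
    go (yes (q₀ , ρ₀ , e)) = begin
      ∑∑ (λ q ρ → isEven q ρ ∧ does (owner q ρ Fin.≟ j))
        ≡⟨ ∑∑-cong {g = λ q ρ → isEven q ρ ∧ hits q ρ}
            (λ q ρ → cong (isEven q ρ ∧_) (indicator j q₀ ρ₀ e q ρ)) ⟩
      ∑∑ (λ q ρ → isEven q ρ ∧ hits q ρ)
        ≡⟨ ∑∑-cong {f = λ q ρ → isEven q ρ ∧ hits q ρ}
            (λ q ρ → ∧-sum {r j} (isEven q ρ) (λ i → does (class? j (toℕ i) q ρ))) ⟩
      ∑∑ (λ q ρ → sum {r j} (λ i → isEven q ρ ∧ does (class? j (toℕ i) q ρ)))
        ≡⟨ ∑∑-comm {r j} (λ q ρ i → isEven q ρ ∧ does (class? j (toℕ i) q ρ)) ⟩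
      sum {r j} (λ i → ∑∑ (λ q ρ → isEven q ρ ∧ does (class? j (toℕ i) q ρ)))
        ≡⟨ sum-cong-≗ (class-sum j) ⟩
      sum {r j} (λ i → evenStep j (toℕ i))
        ≡⟨ evenSteps-even j ⟩
      false ∎
      where
      hits : Fin b → Fin m′ → Bool
      hits q ρ = sum {r j} (λ i → does (class? j (toℕ i) q ρ))
    go (no ¬o) = sum-false λ q → sum-false λ ρ →
      trans (cong (isEven q ρ ∧_) (dec-false (owner q ρ Fin.≟ j) λ e → ¬o (q , ρ , e)))
          (∧-zeroʳ (isEven q ρ))

  even-classes : ∑∑ isEven ≡ false
  even-classes = begin
    ∑∑ isEven
      ≡⟨ ∑∑-cong (λ q ρ → sym (single q ρ)) ⟩
    ∑∑ (λ q ρ → sum (λ j → isEven q ρ ∧ does (owner q ρ Fin.≟ j)))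
      ≡⟨ ∑∑-comm (λ q ρ j → isEven q ρ ∧ does (owner q ρ Fin.≟ j)) ⟩
    sum (λ j → ∑∑ (λ q ρ → isEven q ρ ∧ does (owner q ρ Fin.≟ j)))
      ≡⟨ sum-false owned-sum ⟩
    false ∎
    where
    single : ∀ q ρ → sum (λ j → isEven q ρ ∧ does (owner q ρ Fin.≟ j)) ≡ isEven q ρ
    single q ρ = trans
      (sum-unique (owner q ρ) λ j ne →
        trans (cong (isEven q ρ ∧_) (dec-false (owner q ρ Fin.≟ j) (ne ∘ sym))) (∧-zeroʳ (isEven q ρ)))
      (trans (cong (isEven q ρ ∧_) (dec-true (owner q ρ Fin.≟ owner q ρ) refl)) (∧-identityʳ (isEven q ρ)))

  -- With 4 dividing `m`, each of the b rows contains an odd number of even representatives, as many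
  -- as there are even numbers among 1, ..., m - 1.
  isEven-sum : ∀ x → m′ ≡ 3 ℕ.+ x ℕ.* 4 → ∑∑ isEven ≡ not (even b)
  isEven-sum x refl = trans (sum-cong-≗ λ q → trans
      (sum-cong-≗ λ ρ → trans (cong even (repℕ≡ q ρ)) (trans (even-+ (m ℕ.* toℕ q) (suc (toℕ ρ)))
      (cong (λ e → if e then even (suc (toℕ ρ)) else not (even (suc (toℕ ρ)))) (even-mq (toℕ q)))))
          (sum-even-suc x)) (sum-true b)
    where
    even-mq : ∀ q → even (m ℕ.* q) ≡ true
    even-mq q = trans (cong even (lem x q)) (even-double (2 ℕ.* (suc x ℕ.* q)))
      where
      lem : ∀ x q → suc (3 ℕ.+ x ℕ.* 4) ℕ.* q ≡ 2 ℕ.* (suc x ℕ.* q) ℕ.+ 2 ℕ.* (suc x ℕ.* q)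
      lem = ℕS.solve-∀

-- The two directions of the equivalence

private
  2x : ∀ x → x ℕ.* 2 ≡ x ℕ.+ x
  2x = ℕS.solve-∀

  4x : ∀ x → (x ℕ.+ x) ℕ.* 2 ≡ x ℕ.* 4
  4x = ℕS.solve-∀

  2+4x : ∀ x → suc (x ℕ.+ x) ℕ.* 2 ≡ 2 ℕ.+ x ℕ.* 4
  2+4x = ℕS.solve-∀

module _ (m n : ℕ) (2≤m : 2 ≤ m) (2∣m : 2 ∣ m) (1≤n : 1 ≤ n) where

  sufficient : 2 ∣ n × (n % 4 ≡ 2 → m % 4 ≡ 2) → CyclicSymHCSExists m n
  sufficient (divides b n≡ , mod4) = go 2∣m (halves b) n≡
    where
    absurd : ∀ {b} → n ≡ b ℕ.* 2 → b ≡ 0 → ⊥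
    absurd refl refl = case 1≤n of λ ()
    go : ∀ {b} → 2 ∣ m → Halves b → n ≡ b ℕ.* 2 → CyclicSymHCSExists m n
    go (divides h m≡) hb n≡ with halves h | hb
    -- For m/2 odd, the number ε of short walks is the parity of n/2: it takes care of the row left
    -- without a partner.
    ... | double+1 p | double a = subst₂ CyclicSymHCSExists (sym (trans m≡ (2x (suc (p ℕ.+ p)))))
        (sym (trans n≡ (2x (a ℕ.+ a))))
            (OddHalf.exists p a 0 z≤n (ℕₚ.n≢0⇒n>0 (absurd n≡)))
    ... | double+1 p | double+1 a = subst₂ CyclicSymHCSExists (sym (trans m≡ (2x (suc (p ℕ.+ p)))))
            (sym (trans n≡ (trans (cong (ℕ._* 2) (sym (ℕₚ.+-suc a a))) (2x (a ℕ.+ suc a)))))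
            (OddHalf.exists p a 1 ℕₚ.≤-refl (subst (0 <_) (sym (ℕₚ.+-suc a a)) (s≤s z≤n)))
    ... | double zero | _ = case subst (2 ≤_) m≡ 2≤m of λ ()
    ... | double (suc p′) | double zero = ⊥-elim (absurd n≡ refl)
    ... | double (suc p′) | double (suc a′) = subst₂ CyclicSymHCSExists
        (sym (trans m≡ (2x (suc p′ ℕ.+ suc p′))))
            (sym (trans n≡ (2x (suc a′ ℕ.+ suc a′)))) (EvenHalf.exists p′ a′)
    -- Here 4 divides m and n ≡ 2 modulo 4, which the hypothesis excludes.
    ... | double (suc p′) | double+1 a = case trans (sym m%4≡0) (mod4 n%4≡2) of λ ()
      where
      m%4≡0 : m % 4 ≡ 0
      m%4≡0 = trans (cong (_% 4) (trans m≡ (4x (suc p′)))) (ℕᵈ.m*n%n≡0 (suc p′) 4)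
      n%4≡2 : n % 4 ≡ 2
      n%4≡2 = trans (cong (_% 4) (trans n≡ (2+4x a))) (ℕᵈ.[m+kn]%n≡m%n 2 a 4)

necessary : ∀ m n → 2 ≤ m → 2 ∣ m → 1 ≤ n → CyclicSymHCSExists m n → 2 ∣ n × (n % 4 ≡ 2 → m % 4 ≡ 2)
necessary (suc m′) n@(suc _) 2≤m 2∣m 1≤n (k , C , hcs , cyclic , symmetric) = 2∣n , mod4 2∣m 2∣n
  where
  2∣n : 2 ∣ n
  2∣n = Necessity.EvenDegree.2∣n m′ n k C hcs cyclic symmetric 2∣m
  mod4 : 2 ∣ suc m′ → 2 ∣ n → n % 4 ≡ 2 → suc m′ % 4 ≡ 2
  mod4 (divides x m≡) (divides b n≡) n%4≡2 with halves x | halves b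
  ... | double+1 y | _ = trans (cong (_% 4) (trans m≡ (2+4x y))) (ℕᵈ.[m+kn]%n≡m%n 2 y 4)
  ... | double y | double a = case trans (sym n%4≡2)
      (trans (cong (_% 4) (trans n≡ (4x a))) (ℕᵈ.m*n%n≡0 a 4)) of λ ()
  ... | double zero | double+1 a = case m≡ of λ ()
  -- With 4 dividing m and n/2 odd, the number of even classes is odd by `isEven-sum` and even by
  -- `even-classes`.
  ... | double (suc y) | double+1 a = case trans (sym even-classes)
      (trans (isEven-sum y m′≡) (trans (not-involutive _) (even-double a))) of λ ()
    where
    open EvenClasses m′ n k C hcs cyclic symmetric (suc (a ℕ.+ a)) (trans n≡ (2x (suc (a ℕ.+ a)))) 2∣m
    m′≡ : m′ ≡ 3 ℕ.+ y ℕ.* 4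
    m′≡ = cong ℕ.pred (trans m≡ (4x (suc y)))

theorem1p1 : (m n : ℕ) → 2 ≤ m → 2 ∣ m → 1 ≤ n →
    (CyclicSymHCSExists m n ⇔ (2 ∣ n × (n % 4 ≡ 2 → m % 4 ≡ 2)))
theorem1p1 m n 2≤m 2∣m 1≤n = mk⇔ (necessary m n 2≤m 2∣m 1≤n) (sufficient m n 2≤m 2∣m 1≤n)
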